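{- Let $R$ be a finite Frobenius ring with generating character $\chi$, let $V=R^n$, and let $G$ be a finite permutation group acting on the coordinates of $V$. Let $H$ be a subgroup of $G$ such that $|H|$ has an inverse in $R$. If $C$ is a left $G$-code of length $n$ over $R$, then $$\mathbf{cwe}_H\bigl(((C^{\perp})\theta_H)M_H : \{x_a\}_{a\in R}\bigr) = \frac{1}{|C\theta_H|}\,\mathbf{cwe}_H\Bigl(C\theta_H : \Bigl\{\sum_{b\in R}\chi(ab)\,x_b\Bigr\}_{a\in R}\Bigr),$$ where $M_H$ is the $H$-orbit length matrix.
   Context: A finite (associative, unital) ring $R$ is Frobenius if $R/\mathrm{Rad}(R)\cong \mathrm{Soc}(R_R)$ as right $R$-modules and $R/\mathrm{Rad}(R)\cong\mathrm{Soc}({}_RR)$ as left $R$-modules. $R$ need not be commutative. Let $\widehat R$ be the group of homomorphisms from the additive group of $R$ to $\mathbb{C}^{*}$. A generating character of $R$ is a $\chi\in\widehat R$ that is right generating ($r\mapsto\chi^r$, $\chi^r(x)=\chi(rx)$, is an isomorphism of right $R$-modules $R\to\widehat R$) or left generating ($r\mapsto{}^r\chi$, ${}^r\chi(x)=\chi(xr)$, is an isomorphism of left $R$-modules $R\to\widehat R$); a finite ring is Frobenius if and only if it admits one. On $V=R^n$ put $(u,v):=u_1v_1+\cdots+u_nv_n$. A permutation group $G$ on $\{1,\dots,n\}$ acts on $V$ on the right by $(vg)_i = v_{ig^{ -1}}$. A left $G$-code is a left $R$-submodule $C$ of $V$ with $Cg\subseteq C$ for all $g\in G$; its right dual is $C^{\perp}:=\{u\in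 V:(v,u)=0\text{ for all }v\in C\}$. "$|H|$ has an inverse in $R$" means $|H|\cdot 1_R$ is a unit. Define $v\theta_H:=\frac1{|H|}\sum_{h\in H}vh$ for $v\in V$ and $X\theta_H:=\{v\theta_H:v\in X\}$. Let $H_V(\alpha_1),\dots,H_V(\alpha_t)$ be the orbits of $H$ on $\{1,\dots,n\}$, $m_i$ the cardinality of $H_V(\alpha_i)$, and $\overline{H_V(\alpha_i)}\in V$ the vector with entry $1$ at the positions in $H_V(\alpha_i)$ and $0$ elsewhere. Every $u\in V\theta_H$ is uniquely $u=\sum_{i=1}^t u_i\overline{H_V(\alpha_i)}$ with $u_i\in R$. The $H$-orbit length matrix is $M_H:=\mathrm{diag}(\ell_1,\dots,\ell_n)$ with $\ell_j=m_i$ if $j\in H_V(\alpha_i)$; $YM_H:=\{yM_H:y\in Y\}$ for $Y\subseteq V$. For a left or right $R$-submodule $D\subseteq V\theta_H$, the $H$-complete weight enumerator is $\mathbf{cwe}_H(D:\{x_a\}_{a\in R}):=\sum_{u\in D}\prod_{a\in R}x_a^{n_a^H(u)}$, where $n_a^H(u)$ is the number of $i\in\{1,\dots,t\}$ with $u_i=a$. -}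

module Defs where

open import Algebra.Bundles
  using (Ring; CommutativeRing; RawSemiring; AbelianGroup; CommutativeMonoid)
open import Algebra.Structures using (IsCommutativeRing)
open import Algebra.Definitions using
  ( Congruent₂; Commutative; LeftIdentity; RightInverse; Invertible
  ; _DistributesOverˡ_ )
import Algebra.Consequences.Setoid as Consequences
open import Algebra.Module.Bundles using (LeftModule; RightModule)
open import Algebra.Module.Bundles.Raw using (RawLeftModule; RawRightModule)
open import Algebra.Module.Morphism.Structures
  using (IsLeftModuleIsomorphism; IsRightModuleIsomorphism)
open import Algebra.Morphism.Structures using (module GroupMorphisms)
open GroupMorphisms using (IsGroupHomomorphism)
import Algebra.Definitions.RawMonoid as RawMonoidDefs
import Algebra.Definitions.RawSemiring as RawSemiringDefs
import Algebra.Module.Construct.TensorUnit as TensorUnit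
import Algebra.Properties.AbelianGroup as AbelianGroupProps
import Algebra.Properties.CommutativeMonoid.Sum as SumProps
import Algebra.Properties.CommutativeSemigroup as CommutativeSemigroupProps
import Algebra.Properties.Group as GroupProps
import Algebra.Properties.Ring as RingProps
open import Data.Fin.Base using (Fin; finToFun; funToFin)
import Data.Fin.Base as Fin
open import Data.Fin.Properties
  using (any?; all?; finToFun-funToFin; funToFin-finToFin)
  renaming (_≟_ to _≟ᶠ_)
open import Data.Fin.Permutation
  using (Permutation′; _⟨$⟩ʳ_; _⟨$⟩ˡ_; _∘ₚ_)
  renaming (_≈_ to _≈ₚₑᵣₘ_; id to idₚ; flip to flipₚ)
open import Data.Integer.Base using (+_)
open import Data.List.Base
  using (List; []; _∷_; map; foldr; filter; length; allFin; _++_; cartesianProductWith)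
import Data.List.Membership.Setoid as SetoidMembership
open import Data.List.Membership.Propositional.Properties using (∈-allFin; ∈-filter⁺; ∈-map⁺)
open import Data.List.Membership.Propositional using () renaming (_∈_ to _∈ᴸ_)
open import Data.List.Relation.Unary.Any using (Any)
  renaming (any? to anyᴸ?)
open import Data.List.Relation.Unary.Unique.Setoid using (Unique)
open import Data.Nat.Base as ℕ using (ℕ; zero; suc)
import Data.Nat.Properties as ℕ
open import Data.Product.Base using (∃; _×_; _,_; proj₁; proj₂)
open import Data.Rational.Base as ℚ using (ℚ; 0ℚ; 1ℚ; ½)
import Data.Rational.Properties as ℚ
open import Data.Rational.Solver using (module +-*-Solver)
open import Data.Sum.Base using (_⊎_)
open import Data.Vec.Base as Vec using (Vec)
open import Data.Vec.Properties using (≡-dec)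
import Data.Vec.Functional.Relation.Binary.Equality.Setoid as VecEq
open import Function.Base using (_∘_)
open import Function.Bundles using (Inverse)
open import Level using (Level; _⊔_; 0ℓ) renaming (suc to lsuc)
open import Relation.Binary.Bundles using (Setoid)
open import Relation.Binary.Structures using (IsEquivalence)
open import Relation.Binary.Definitions using (_Respects_)
import Relation.Binary.PropositionalEquality as ≡
open ≡ using (_≡_)
open import Relation.Nullary using (¬_; Dec; does)
open import Relation.Nullary.Decidable using (map′; _→-dec_; _×-dec_)
open import Relation.Unary using (Pred; Decidable)
open import Data.Bool.Base using (if_then_else_)

private variable
  c ℓ p : Level
  n : ℕ

IsCauchy : (ℕ → ℚ) → Set
IsCauchy x = ∀ ε → 0ℚ ℚ.< ε →
  ∃ λ N → ∀ m n → N ℕ.≤ m → N ℕ.≤ n → ℚ.∣ x m ℚ.- x n ∣ ℚ.< ε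

record ℝ : Set where
  constructor mkℝ
  field
    seq    : ℕ → ℚ
    cauchy : IsCauchy seq
open ℝ public

infix 4 _≈ʳ_ _≈ᶜ_

record _≈ʳ_ (x y : ℝ) : Set where
  constructor mk≈ʳ
  field
    close : ∀ ε → 0ℚ ℚ.< ε →
      ∃ λ N → ∀ n → N ℕ.≤ n → ℚ.∣ seq x n ℚ.- seq y n ∣ ℚ.< ε
open _≈ʳ_ public

module RationalBounds where
  open ℚ.≤-Reasoning

  0<½* : ∀ ε → 0ℚ ℚ.< ε → 0ℚ ℚ.< ½ ℚ.* ε
  0<½* ε ε>0 = ℚ.positive⁻¹ _ {{ℚ.pos*pos⇒pos ½ ε {{ℚ.positive ε>0}}}}

  ½+½ : ∀ ε → ½ ℚ.* ε ℚ.+ ½ ℚ.* ε ≡ ε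
  ½+½ = solve 1 (λ e → con ½ :* e :+ con ½ :* e := e) ≡.refl
    where open +-*-Solver

  +-split : ∀ a b c d → (a ℚ.+ b) ℚ.- (c ℚ.+ d) ≡ (a ℚ.- c) ℚ.+ (b ℚ.- d)
  +-split = solve 4 (λ a b c d → (a :+ b) :- (c :+ d) := (a :- c) :+ (b :- d)) ≡.refl
    where open +-*-Solver

  *-split : ∀ a b c d → a ℚ.* b ℚ.- c ℚ.* d ≡ a ℚ.* (b ℚ.- d) ℚ.+ d ℚ.* (a ℚ.- c)
  *-split = solve 4 (λ a b c d → a :* b :- c :* d := a :* (b :- d) :+ d :* (a :- c)) ≡.refl
    where open +-*-Solver

  neg-split : ∀ a b → ℚ.- a ℚ.- ℚ.- b ≡ ℚ.- (a ℚ.- b)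
  neg-split = solve 2 (λ a b → :- a :- :- b := :- (a :- b)) ≡.refl
    where open +-*-Solver

  sym-split : ∀ a b → b ℚ.- a ≡ ℚ.- (a ℚ.- b)
  sym-split = solve 2 (λ a b → b :- a := :- (a :- b)) ≡.refl
    where open +-*-Solver

  trans-split : ∀ a b c → a ℚ.- c ≡ (a ℚ.- b) ℚ.+ (b ℚ.- c)
  trans-split = solve 3 (λ a b c → a :- c := (a :- b) :+ (b :- c)) ≡.refl
    where open +-*-Solver

  self-split : ∀ a b → b ≡ a ℚ.+ (b ℚ.- a)
  self-split = solve 2 (λ a b → b := a :+ (b :- a)) ≡.refl
    where open +-*-Solver

  ∣-∣-neg : ∀ {ε} p q → q ≡ ℚ.- p → ℚ.∣ p ∣ ℚ.< ε → ℚ.∣ q ∣ ℚ.< ε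
  ∣-∣-neg {ε} p q eq p<ε = begin-strict
    ℚ.∣ q ∣       ≡⟨ ≡.cong ℚ.∣_∣ eq ⟩
    ℚ.∣ ℚ.- p ∣   ≡⟨ ℚ.∣-p∣≡∣p∣ p ⟩
    ℚ.∣ p ∣       <⟨ p<ε ⟩
    ε             ∎

  ∣-∣-add : ∀ ε p q s → s ≡ p ℚ.+ q →
    ℚ.∣ p ∣ ℚ.< ½ ℚ.* ε → ℚ.∣ q ∣ ℚ.< ½ ℚ.* ε → ℚ.∣ s ∣ ℚ.< ε
  ∣-∣-add ε p q s eq p< q< = begin-strict
    ℚ.∣ s ∣                 ≡⟨ ≡.cong ℚ.∣_∣ eq ⟩
    ℚ.∣ p ℚ.+ q ∣           ≤⟨ ℚ.∣p+q∣≤∣p∣+∣q∣ p q ⟩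
    ℚ.∣ p ∣ ℚ.+ ℚ.∣ q ∣     <⟨ ℚ.+-mono-< p< q< ⟩
    ½ ℚ.* ε ℚ.+ ½ ℚ.* ε     ≡⟨ ½+½ ε ⟩
    ε                       ∎

  module _ (B : ℚ) (B>0 : 0ℚ ℚ.< B) where
    instance
      B-pos : ℚ.Positive B
      B-pos = ℚ.positive B>0
      B-nz : ℚ.NonZero B
      B-nz = ℚ.pos⇒nonZero B

    _/B : ℚ → ℚ
    ε /B = ℚ.1/ B ℚ.* ε

    /B>0 : ∀ ε → 0ℚ ℚ.< ε → 0ℚ ℚ.< ε /B
    /B>0 ε ε>0 = ℚ.positive⁻¹ _
      {{ℚ.pos*pos⇒pos (ℚ.1/ B) {{ℚ.1/pos⇒pos B}} ε {{ℚ.positive ε>0}}}}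

    ∣-∣-scale : ∀ ε p q → ℚ.∣ p ∣ ℚ.≤ B → ℚ.∣ q ∣ ℚ.< ε /B → ℚ.∣ p ℚ.* q ∣ ℚ.< ε
    ∣-∣-scale ε p q p≤ q< = begin-strict
      ℚ.∣ p ℚ.* q ∣             ≡⟨ ℚ.∣p*q∣≡∣p∣*∣q∣ p q ⟩
      ℚ.∣ p ∣ ℚ.* ℚ.∣ q ∣       ≤⟨ ℚ.*-monoʳ-≤-nonNeg ℚ.∣ q ∣ {{ℚ.nonNegative (ℚ.0≤∣p∣ q)}} p≤ ⟩
      B ℚ.* ℚ.∣ q ∣             <⟨ ℚ.*-monoʳ-<-pos B q< ⟩
      B ℚ.* (ℚ.1/ B ℚ.* ε)      ≡⟨ ≡.sym (ℚ.*-assoc B (ℚ.1/ B) ε) ⟩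
      B ℚ.* ℚ.1/ B ℚ.* ε        ≡⟨ ≡.cong (ℚ._* ε) (ℚ.*-inverseʳ B) ⟩
      1ℚ ℚ.* ε                  ≡⟨ ℚ.*-identityˡ ε ⟩
      ε                         ∎

  module Limit {I : Set} (F : ℕ → I → Set)
               (anti : ∀ {M N} → M ℕ.≤ N → ∀ {i} → F N i → F M i) where

    Close : (x x′ : I → ℚ) → Set
    Close x x′ = ∀ ε → 0ℚ ℚ.< ε → ∃ λ N → ∀ i → F N i → ℚ.∣ x i ℚ.- x′ i ∣ ℚ.< ε

    Bounded : (I → ℚ) → Set
    Bounded x = ∃ λ B → 0ℚ ℚ.< B × ∃ λ N → ∀ i → F N i → ℚ.∣ x i ∣ ℚ.≤ B

    close-sym : ∀ x x′ → Close x x′ → Close x′ x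
    close-sym x x′ h ε ε>0 with h ε ε>0
    ... | N , h = N , λ i Fi → ∣-∣-neg _ _ (sym-split (x i) (x′ i)) (h i Fi)

    close-trans : ∀ x y z → Close x y → Close y z → Close x z
    close-trans x y z h k ε ε>0 with h (½ ℚ.* ε) (0<½* ε ε>0) | k (½ ℚ.* ε) (0<½* ε ε>0)
    ... | M , h | N , k = M ℕ.⊔ N , λ i Fi →
      ∣-∣-add ε _ _ _ (trans-split (x i) (y i) (z i))
        (h i (anti (ℕ.m≤m⊔n M N) Fi)) (k i (anti (ℕ.m≤n⊔m M N) Fi))

    close-neg : ∀ x x′ → Close x x′ → Close (λ i → ℚ.- x i) (λ i → ℚ.- x′ i)
    close-neg x x′ h ε ε>0 with h ε ε>0
    ... | N , h = N , λ i Fi → ∣-∣-neg _ _ (neg-split (x i) (x′ i)) (h i Fi)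

    close-+ : ∀ x y x′ y′ → Close x x′ → Close y y′ →
      Close (λ i → x i ℚ.+ y i) (λ i → x′ i ℚ.+ y′ i)
    close-+ x y x′ y′ h k ε ε>0 with h (½ ℚ.* ε) (0<½* ε ε>0) | k (½ ℚ.* ε) (0<½* ε ε>0)
    ... | M , h | N , k = M ℕ.⊔ N , λ i Fi →
      ∣-∣-add ε _ _ _ (+-split (x i) (y i) (x′ i) (y′ i))
        (h i (anti (ℕ.m≤m⊔n M N) Fi)) (k i (anti (ℕ.m≤n⊔m M N) Fi))

    close-* : ∀ x y x′ y′ → Bounded x → Bounded y′ → Close x x′ → Close y y′ →
      Close (λ i → x i ℚ.* y i) (λ i → x′ i ℚ.* y′ i)
    close-* x y x′ y′ (B , B>0 , K , hB) (C , C>0 , L , hC) h k ε ε>0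
      with h (_/B C C>0 (½ ℚ.* ε)) (/B>0 C C>0 _ (0<½* ε ε>0))
         | k (_/B B B>0 (½ ℚ.* ε)) (/B>0 B B>0 _ (0<½* ε ε>0))
    ... | M , h | N , k = (K ℕ.⊔ L) ℕ.⊔ (M ℕ.⊔ N) , λ i Fi →
      let FKL = anti (ℕ.m≤m⊔n (K ℕ.⊔ L) (M ℕ.⊔ N)) Fi
          FMN = anti (ℕ.m≤n⊔m (K ℕ.⊔ L) (M ℕ.⊔ N)) Fi
      in ∣-∣-add ε _ _ _ (*-split (x i) (y i) (x′ i) (y′ i))
           (∣-∣-scale B B>0 (½ ℚ.* ε) (x i) _
             (hB i (anti (ℕ.m≤m⊔n K L) FKL)) (k i (anti (ℕ.m≤n⊔m M N) FMN)))
           (∣-∣-scale C C>0 (½ ℚ.* ε) (y′ i) _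
             (hC i (anti (ℕ.m≤n⊔m K L) FKL)) (h i (anti (ℕ.m≤m⊔n M N) FMN)))

  Both : ℕ → ℕ × ℕ → Set
  Both N (m , n) = N ℕ.≤ m × N ℕ.≤ n

  module L₁ = Limit ℕ._≤_ (λ M≤N N≤i → ℕ.≤-trans M≤N N≤i)
  module L₂ = Limit Both (λ M≤N (h , k) → ℕ.≤-trans M≤N h , ℕ.≤-trans M≤N k)

  uncurryᶜ : ∀ x → IsCauchy x → L₂.Close (x ∘ proj₁) (x ∘ proj₂)
  uncurryᶜ x h ε ε>0 with h ε ε>0
  ... | N , h = N , λ i Fi → h (proj₁ i) (proj₂ i) (proj₁ Fi) (proj₂ Fi)

  curryᶜ : ∀ x → L₂.Close (x ∘ proj₁) (x ∘ proj₂) → IsCauchy x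
  curryᶜ x h ε ε>0 with h ε ε>0
  ... | N , h = N , λ m n hm hn → h (m , n) (hm , hn)

  bounded : ∀ x → IsCauchy x → L₁.Bounded x
  bounded x h with h 1ℚ (ℚ.positive⁻¹ 1ℚ)
  ... | N , h = ℚ.∣ x N ∣ ℚ.+ 1ℚ
      , (begin-strict
      0ℚ                     ≤⟨ ℚ.0≤∣p∣ (x N) ⟩
      ℚ.∣ x N ∣              ≡⟨ ≡.sym (ℚ.+-identityʳ ℚ.∣ x N ∣) ⟩
      ℚ.∣ x N ∣ ℚ.+ 0ℚ       <⟨ ℚ.+-monoʳ-< ℚ.∣ x N ∣ (ℚ.positive⁻¹ 1ℚ) ⟩
      ℚ.∣ x N ∣ ℚ.+ 1ℚ       ∎)
      , N , λ n N≤n → begin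
      ℚ.∣ x n ∣                           ≡⟨ ≡.cong ℚ.∣_∣ (self-split (x N) (x n)) ⟩
      ℚ.∣ x N ℚ.+ (x n ℚ.- x N) ∣         ≤⟨ ℚ.∣p+q∣≤∣p∣+∣q∣ (x N) (x n ℚ.- x N) ⟩
      ℚ.∣ x N ∣ ℚ.+ ℚ.∣ x n ℚ.- x N ∣     ≤⟨ ℚ.+-monoʳ-≤ ℚ.∣ x N ∣ (ℚ.<⇒≤ (h n N N≤n ℕ.≤-refl)) ⟩
      ℚ.∣ x N ∣ ℚ.+ 1ℚ                    ∎

  reindex : (π : ℕ × ℕ → ℕ) → (∀ {N i} → Both N i → N ℕ.≤ π i) →
    ∀ x → L₁.Bounded x → L₂.Bounded (x ∘ π)
  reindex π Both⇒ x (B , B>0 , N , h) = B , B>0 , N , λ i Fi → h (π i) (Both⇒ Fi)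

  bounded₁ : ∀ x → IsCauchy x → L₂.Bounded (x ∘ proj₁)
  bounded₁ x h = reindex proj₁ proj₁ x (bounded x h)

  bounded₂ : ∀ x → IsCauchy x → L₂.Bounded (x ∘ proj₂)
  bounded₂ x h = reindex proj₂ proj₂ x (bounded x h)

  cauchy-+ : ∀ x y → IsCauchy x → IsCauchy y → IsCauchy (λ n → x n ℚ.+ y n)
  cauchy-+ x y h k = curryᶜ (λ n → x n ℚ.+ y n)
    (L₂.close-+ (x ∘ proj₁) (y ∘ proj₁) (x ∘ proj₂) (y ∘ proj₂) (uncurryᶜ x h) (uncurryᶜ y k))

  cauchy-neg : ∀ x → IsCauchy x → IsCauchy (λ n → ℚ.- x n)
  cauchy-neg x h = curryᶜ (λ n → ℚ.- x n)
    (L₂.close-neg (x ∘ proj₁) (x ∘ proj₂) (uncurryᶜ x h))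

  cauchy-* : ∀ x y → IsCauchy x → IsCauchy y → IsCauchy (λ n → x n ℚ.* y n)
  cauchy-* x y h k = curryᶜ (λ n → x n ℚ.* y n)
    (L₂.close-* (x ∘ proj₁) (y ∘ proj₁) (x ∘ proj₂) (y ∘ proj₂)
      (bounded₁ x h) (bounded₂ y k) (uncurryᶜ x h) (uncurryᶜ y k))

  ∣-∣-refl : ∀ {ε} p q → p ≡ q → 0ℚ ℚ.< ε → ℚ.∣ p ℚ.- q ∣ ℚ.< ε
  ∣-∣-refl {ε} p .p ≡.refl ε>0 = ≡.subst (ℚ._< ε) (≡.sym (≡.cong ℚ.∣_∣ (ℚ.+-inverseʳ p))) ε>0

open RationalBounds

infixl 6 _+ʳ_ _-ʳ_
infixl 7 _*ʳ_
infix  8 -ʳ_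

fromℚ : ℚ → ℝ
fromℚ q = mkℝ (λ _ → q) λ ε ε>0 → 0 , λ _ _ _ _ → ∣-∣-refl q q ≡.refl ε>0

-- Opaque only so that type checking does not unfold rational arithmetic.
opaque
  _+ʳ_ : ℝ → ℝ → ℝ
  mkℝ x h +ʳ mkℝ y k = mkℝ (λ n → x n ℚ.+ y n) (cauchy-+ x y h k)

  -ʳ_ : ℝ → ℝ
  -ʳ mkℝ x h = mkℝ (λ n → ℚ.- x n) (cauchy-neg x h)

  _*ʳ_ : ℝ → ℝ → ℝ
  mkℝ x h *ʳ mkℝ y k = mkℝ (λ n → x n ℚ.* y n) (cauchy-* x y h k)

_-ʳ_ : ℝ → ℝ → ℝ
x -ʳ y = x +ʳ -ʳ y

pointwise : ∀ {x y} → (∀ n → seq x n ≡ seq y n) → x ≈ʳ y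
pointwise {x} {y} eq = mk≈ʳ λ ε ε>0 → 0 , λ n _ → ∣-∣-refl (seq x n) (seq y n) (eq n) ε>0

≈ʳ-refl : ∀ {x} → x ≈ʳ x
≈ʳ-refl = pointwise λ _ → ≡.refl

≈ʳ-sym : ∀ {x y} → x ≈ʳ y → y ≈ʳ x
≈ʳ-sym {x} {y} (mk≈ʳ h) = mk≈ʳ (L₁.close-sym (seq x) (seq y) h)

≈ʳ-trans : ∀ {x y z} → x ≈ʳ y → y ≈ʳ z → x ≈ʳ z
≈ʳ-trans {x} {y} {z} (mk≈ʳ h) (mk≈ʳ k) = mk≈ʳ (L₁.close-trans (seq x) (seq y) (seq z) h k)

opaque
  unfolding _+ʳ_ -ʳ_ _*ʳ_

  +ʳ-cong : ∀ {x x′ y y′} → x ≈ʳ x′ → y ≈ʳ y′ → x +ʳ y ≈ʳ x′ +ʳ y′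
  +ʳ-cong {x} {x′} {y} {y′} (mk≈ʳ h) (mk≈ʳ k) = mk≈ʳ (L₁.close-+ (seq x) (seq y) (seq x′) (seq y′) h k)

  -ʳ-cong : ∀ {x x′} → x ≈ʳ x′ → -ʳ x ≈ʳ -ʳ x′
  -ʳ-cong {x} {x′} (mk≈ʳ h) = mk≈ʳ (L₁.close-neg (seq x) (seq x′) h)

  *ʳ-cong : ∀ {x x′ y y′} → x ≈ʳ x′ → y ≈ʳ y′ → x *ʳ y ≈ʳ x′ *ʳ y′
  *ʳ-cong {x} {x′} {y} {y′} (mk≈ʳ h) (mk≈ʳ k) = mk≈ʳ
    (L₁.close-* (seq x) (seq y) (seq x′) (seq y′) (bounded (seq x) (cauchy x)) (bounded (seq y′) (cauchy y′)) h k)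

record ℂ : Set where
  constructor _+i_
  field
    re im : ℝ
open ℂ public

record _≈ᶜ_ (z w : ℂ) : Set where
  constructor mk≈ᶜ
  field
    re-≈ : re z ≈ʳ re w
    im-≈ : im z ≈ʳ im w
open _≈ᶜ_ public

infixl 6 _+ᶜ_
infixl 7 _*ᶜ_
infix  8 -ᶜ_

fromℚᶜ : ℚ → ℂ
fromℚᶜ q = fromℚ q +i fromℚ 0ℚ

0ᶜ 1ᶜ : ℂ
0ᶜ = fromℚᶜ 0ℚ
1ᶜ = fromℚᶜ 1ℚ

_+ᶜ_ _*ᶜ_ : ℂ → ℂ → ℂ
z +ᶜ w = (re z +ʳ re w) +i (im z +ʳ im w)
z *ᶜ w = (re z *ʳ re w -ʳ im z *ʳ im w) +i (re z *ʳ im w +ʳ im z *ʳ re w)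

-ᶜ_ : ℂ → ℂ
-ᶜ z = (-ʳ re z) +i (-ʳ im z)

module ComplexLaws where
  open +-*-Solver

  +-assocʳᵠ : ∀ a b c → (a ℚ.+ b) ℚ.+ c ≡
    a ℚ.+ (b ℚ.+ c)
  +-assocʳᵠ = solve 3 (λ a b c →
    (a :+ b) :+ c :=
    a :+ (b :+ c)) ≡.refl

  +-commʳᵠ : ∀ a b → a ℚ.+ b ≡
    b ℚ.+ a
  +-commʳᵠ = solve 2 (λ a b →
    a :+ b :=
    b :+ a) ≡.refl

  +-identityˡʳᵠ : ∀ a → 0ℚ ℚ.+ a ≡
    a
  +-identityˡʳᵠ = solve 1 (λ a →
    con 0ℚ :+ a :=
    a) ≡.refl

  +-inverseʳʳᵠ : ∀ a → a ℚ.+ ℚ.- a ≡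
    0ℚ
  +-inverseʳʳᵠ = solve 1 (λ a →
    a :+ :- a :=
    con 0ℚ) ≡.refl

  assoc-reᵠ : ∀ a b c d e f → (a ℚ.* c ℚ.+ ℚ.- (b ℚ.* d)) ℚ.* e ℚ.+ ℚ.- ((a ℚ.* d ℚ.+ b ℚ.* c) ℚ.* f) ≡
    a ℚ.* (c ℚ.* e ℚ.+ ℚ.- (d ℚ.* f)) ℚ.+ ℚ.- (b ℚ.* (c ℚ.* f ℚ.+ d ℚ.* e))
  assoc-reᵠ = solve 6 (λ a b c d e f →
    (a :* c :+ :- (b :* d)) :* e :+ :- ((a :* d :+ b :* c) :* f) :=
    a :* (c :* e :+ :- (d :* f)) :+ :- (b :* (c :* f :+ d :* e))) ≡.refl

  assoc-imᵠ : ∀ a b c d e f → (a ℚ.* c ℚ.+ ℚ.- (b ℚ.* d)) ℚ.* f ℚ.+ (a ℚ.* d ℚ.+ b ℚ.* c) ℚ.* e ≡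
    a ℚ.* (c ℚ.* f ℚ.+ d ℚ.* e) ℚ.+ b ℚ.* (c ℚ.* e ℚ.+ ℚ.- (d ℚ.* f))
  assoc-imᵠ = solve 6 (λ a b c d e f →
    (a :* c :+ :- (b :* d)) :* f :+ (a :* d :+ b :* c) :* e :=
    a :* (c :* f :+ d :* e) :+ b :* (c :* e :+ :- (d :* f))) ≡.refl

  identity-reᵠ : ∀ a b → 1ℚ ℚ.* a ℚ.+ ℚ.- (0ℚ ℚ.* b) ≡
    a
  identity-reᵠ = solve 2 (λ a b →
    con 1ℚ :* a :+ :- (con 0ℚ :* b) :=
    a) ≡.refl

  identity-imᵠ : ∀ a b → 1ℚ ℚ.* b ℚ.+ 0ℚ ℚ.* a ≡
    b
  identity-imᵠ = solve 2 (λ a b →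
    con 1ℚ :* b :+ con 0ℚ :* a :=
    b) ≡.refl

  distrib-reᵠ : ∀ a b c d e f → a ℚ.* (c ℚ.+ e) ℚ.+ ℚ.- (b ℚ.* (d ℚ.+ f)) ≡
    (a ℚ.* c ℚ.+ ℚ.- (b ℚ.* d)) ℚ.+ (a ℚ.* e ℚ.+ ℚ.- (b ℚ.* f))
  distrib-reᵠ = solve 6 (λ a b c d e f →
    a :* (c :+ e) :+ :- (b :* (d :+ f)) :=
    (a :* c :+ :- (b :* d)) :+ (a :* e :+ :- (b :* f))) ≡.refl

  distrib-imᵠ : ∀ a b c d e f → a ℚ.* (d ℚ.+ f) ℚ.+ b ℚ.* (c ℚ.+ e) ≡
    (a ℚ.* d ℚ.+ b ℚ.* c) ℚ.+ (a ℚ.* f ℚ.+ b ℚ.* e)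
  distrib-imᵠ = solve 6 (λ a b c d e f →
    a :* (d :+ f) :+ b :* (c :+ e) :=
    (a :* d :+ b :* c) :+ (a :* f :+ b :* e)) ≡.refl

  comm-reᵠ : ∀ a b c d → a ℚ.* c ℚ.+ ℚ.- (b ℚ.* d) ≡
    c ℚ.* a ℚ.+ ℚ.- (d ℚ.* b)
  comm-reᵠ = solve 4 (λ a b c d →
    a :* c :+ :- (b :* d) :=
    c :* a :+ :- (d :* b)) ≡.refl

  comm-imᵠ : ∀ a b c d → a ℚ.* d ℚ.+ b ℚ.* c ≡
    c ℚ.* b ℚ.+ d ℚ.* a
  comm-imᵠ = solve 4 (λ a b c d →
    a :* d :+ b :* c :=
    c :* b :+ d :* a) ≡.refl

  opaque
    unfolding _+ʳ_ -ʳ_ _*ʳ_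

    +-assocʳ : ∀ a b c → (a +ʳ b) +ʳ c ≈ʳ
      a +ʳ (b +ʳ c)
    +-assocʳ a b c = pointwise λ n → +-assocʳᵠ (seq a n) (seq b n) (seq c n)

    +-commʳ : ∀ a b → a +ʳ b ≈ʳ
      b +ʳ a
    +-commʳ a b = pointwise λ n → +-commʳᵠ (seq a n) (seq b n)

    +-identityˡʳ : ∀ a → fromℚ 0ℚ +ʳ a ≈ʳ
      a
    +-identityˡʳ a = pointwise λ n → +-identityˡʳᵠ (seq a n)

    +-inverseʳʳ : ∀ a → a -ʳ a ≈ʳ
      fromℚ 0ℚ
    +-inverseʳʳ a = pointwise λ n → +-inverseʳʳᵠ (seq a n)

    assoc-re : ∀ a b c d e f → (a *ʳ c -ʳ (b *ʳ d)) *ʳ e -ʳ ((a *ʳ d +ʳ b *ʳ c) *ʳ f) ≈ʳ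
      a *ʳ (c *ʳ e -ʳ (d *ʳ f)) -ʳ (b *ʳ (c *ʳ f +ʳ d *ʳ e))
    assoc-re a b c d e f = pointwise λ n → assoc-reᵠ (seq a n) (seq b n) (seq c n) (seq d n) (seq e n) (seq f n)

    assoc-im : ∀ a b c d e f → (a *ʳ c -ʳ (b *ʳ d)) *ʳ f +ʳ (a *ʳ d +ʳ b *ʳ c) *ʳ e ≈ʳ
      a *ʳ (c *ʳ f +ʳ d *ʳ e) +ʳ b *ʳ (c *ʳ e -ʳ (d *ʳ f))
    assoc-im a b c d e f = pointwise λ n → assoc-imᵠ (seq a n) (seq b n) (seq c n) (seq d n) (seq e n) (seq f n)

    identity-re : ∀ a b → fromℚ 1ℚ *ʳ a -ʳ (fromℚ 0ℚ *ʳ b) ≈ʳ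
      a
    identity-re a b = pointwise λ n → identity-reᵠ (seq a n) (seq b n)

    identity-im : ∀ a b → fromℚ 1ℚ *ʳ b +ʳ fromℚ 0ℚ *ʳ a ≈ʳ
      b
    identity-im a b = pointwise λ n → identity-imᵠ (seq a n) (seq b n)

    distrib-re : ∀ a b c d e f → a *ʳ (c +ʳ e) -ʳ (b *ʳ (d +ʳ f)) ≈ʳ
      (a *ʳ c -ʳ (b *ʳ d)) +ʳ (a *ʳ e -ʳ (b *ʳ f))
    distrib-re a b c d e f = pointwise λ n → distrib-reᵠ (seq a n) (seq b n) (seq c n) (seq d n) (seq e n) (seq f n)

    distrib-im : ∀ a b c d e f → a *ʳ (d +ʳ f) +ʳ b *ʳ (c +ʳ e) ≈ʳ
      (a *ʳ d +ʳ b *ʳ c) +ʳ (a *ʳ f +ʳ b *ʳ e)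
    distrib-im a b c d e f = pointwise λ n → distrib-imᵠ (seq a n) (seq b n) (seq c n) (seq d n) (seq e n) (seq f n)

    comm-re : ∀ a b c d → a *ʳ c -ʳ (b *ʳ d) ≈ʳ
      c *ʳ a -ʳ (d *ʳ b)
    comm-re a b c d = pointwise λ n → comm-reᵠ (seq a n) (seq b n) (seq c n) (seq d n)

    comm-im : ∀ a b c d → a *ʳ d +ʳ b *ʳ c ≈ʳ
      c *ʳ b +ʳ d *ʳ a
    comm-im a b c d = pointwise λ n → comm-imᵠ (seq a n) (seq b n) (seq c n) (seq d n)

  ≈ᶜ-isEquivalence : IsEquivalence _≈ᶜ_
  ≈ᶜ-isEquivalence = record
    { refl  = mk≈ᶜ ≈ʳ-refl ≈ʳ-refl
    ; sym   = λ (mk≈ᶜ h k) → mk≈ᶜ (≈ʳ-sym h) (≈ʳ-sym k)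
    ; trans = λ (mk≈ᶜ h k) (mk≈ᶜ h′ k′) → mk≈ᶜ (≈ʳ-trans h h′) (≈ʳ-trans k k′)
    }

  ℂ-setoid : Setoid 0ℓ 0ℓ
  ℂ-setoid = record { isEquivalence = ≈ᶜ-isEquivalence }

  +ᶜ-cong : Congruent₂ _≈ᶜ_ _+ᶜ_
  +ᶜ-cong (mk≈ᶜ h k) (mk≈ᶜ h′ k′) = mk≈ᶜ (+ʳ-cong h h′) (+ʳ-cong k k′)

  *ᶜ-cong : Congruent₂ _≈ᶜ_ _*ᶜ_
  *ᶜ-cong (mk≈ᶜ h k) (mk≈ᶜ h′ k′) = mk≈ᶜ
    (+ʳ-cong (*ʳ-cong h h′) (-ʳ-cong (*ʳ-cong k k′)))
    (+ʳ-cong (*ʳ-cong h k′) (*ʳ-cong k h′))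

  +ᶜ-comm : Commutative _≈ᶜ_ _+ᶜ_
  +ᶜ-comm (a +i b) (c +i d) = mk≈ᶜ (+-commʳ a c) (+-commʳ b d)

  *ᶜ-comm : Commutative _≈ᶜ_ _*ᶜ_
  *ᶜ-comm (a +i b) (c +i d) = mk≈ᶜ (comm-re a b c d) (comm-im a b c d)

  +ᶜ-identityˡ : LeftIdentity _≈ᶜ_ 0ᶜ _+ᶜ_
  +ᶜ-identityˡ (a +i b) = mk≈ᶜ (+-identityˡʳ a) (+-identityˡʳ b)

  *ᶜ-identityˡ : LeftIdentity _≈ᶜ_ 1ᶜ _*ᶜ_
  *ᶜ-identityˡ (a +i b) = mk≈ᶜ (identity-re a b) (identity-im a b)

  -ᶜ-inverseʳ : RightInverse _≈ᶜ_ 0ᶜ -ᶜ_ _+ᶜ_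
  -ᶜ-inverseʳ (a +i b) = mk≈ᶜ (+-inverseʳʳ a) (+-inverseʳʳ b)

  distribˡᶜ : _DistributesOverˡ_ _≈ᶜ_ _*ᶜ_ _+ᶜ_
  distribˡᶜ (a +i b) (c +i d) (e +i f) = mk≈ᶜ (distrib-re a b c d e f) (distrib-im a b c d e f)

ℂ-isCommutativeRing : IsCommutativeRing _≈ᶜ_ _+ᶜ_ _*ᶜ_ -ᶜ_ 0ᶜ 1ᶜ
ℂ-isCommutativeRing = record
  { isRing = record
    { +-isAbelianGroup = record
      { isGroup = record
        { isMonoid = record
          { isSemigroup = record
            { isMagma = record { isEquivalence = ≈ᶜ-isEquivalence ; ∙-cong = +ᶜ-cong }
            ; assoc = λ (a +i b) (c +i d) (e +i f) → mk≈ᶜ (+-assocʳ a c e) (+-assocʳ b d f)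
            }
          ; identity = comm∧idˡ⇒id +ᶜ-comm +ᶜ-identityˡ
          }
        ; inverse = comm∧invʳ⇒inv +ᶜ-comm -ᶜ-inverseʳ
        ; ⁻¹-cong = λ (mk≈ᶜ h k) → mk≈ᶜ (-ʳ-cong h) (-ʳ-cong k)
        }
      ; comm = +ᶜ-comm
      }
    ; *-cong     = *ᶜ-cong
    ; *-assoc    = λ (a +i b) (c +i d) (e +i f) → mk≈ᶜ (assoc-re a b c d e f) (assoc-im a b c d e f)
    ; *-identity = comm∧idˡ⇒id *ᶜ-comm *ᶜ-identityˡ
    ; distrib    = comm∧distrˡ⇒distr +ᶜ-cong *ᶜ-comm distribˡᶜ
    }
  ; *-comm = *ᶜ-comm
  }
  where
  open ComplexLaws
  open Consequences ℂ-setoid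

ℂ-commutativeRing : CommutativeRing 0ℓ 0ℓ
ℂ-commutativeRing = record { isCommutativeRing = ℂ-isCommutativeRing }

ℂ-*-monoid : CommutativeMonoid 0ℓ 0ℓ
ℂ-*-monoid = CommutativeRing.*-commutativeMonoid ℂ-commutativeRing

record ℂˣ : Set where
  no-eta-equality
  field
    value   : ℂ
    inverse : ℂ
    value*inverse : value *ᶜ inverse ≈ᶜ 1ᶜ
open ℂˣ public using (value)

record _≈ˣ_ (z w : ℂˣ) : Set where
  constructor mk≈ˣ
  field
    value-≈ : value z ≈ᶜ value w

module _ where
  open ℂˣ
  open CommutativeMonoid ℂ-*-monoid
  open CommutativeSemigroupProps commutativeSemigroup using (interchange)

  _*ˣ_ : ℂˣ → ℂˣ → ℂˣ
  (z *ˣ w) .value         = value z *ᶜ value w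
  (z *ˣ w) .inverse       = inverse z *ᶜ inverse w
  (z *ˣ w) .value*inverse = trans (interchange (value z) (value w) (inverse z) (inverse w))
    (trans (∙-cong (value*inverse z) (value*inverse w)) (identityˡ 1ᶜ))

  1ˣ : ℂˣ
  1ˣ .value         = 1ᶜ
  1ˣ .inverse       = 1ᶜ
  1ˣ .value*inverse = identityˡ 1ᶜ

  _⁻¹ˣ : ℂˣ → ℂˣ
  (z ⁻¹ˣ) .value         = inverse z
  (z ⁻¹ˣ) .inverse       = value z
  (z ⁻¹ˣ) .value*inverse = trans (comm (inverse z) (value z)) (value*inverse z)

ℂˣ-abelianGroup : AbelianGroup 0ℓ 0ℓ
ℂˣ-abelianGroup = record
  { Carrier = ℂˣ
  ; _≈_ = _≈ˣ_
  ; _∙_ = _*ˣ_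
  ; ε = 1ˣ
  ; _⁻¹ = _⁻¹ˣ
  ; isAbelianGroup = record
    { isGroup = record
      { isMonoid = record
        { isSemigroup = record
          { isMagma = record
            { isEquivalence = record
              { refl  = mk≈ˣ refl
              ; sym   = λ (mk≈ˣ p) → mk≈ˣ (sym p)
              ; trans = λ (mk≈ˣ p) (mk≈ˣ q) → mk≈ˣ (trans p q)
              }
            ; ∙-cong = λ (mk≈ˣ p) (mk≈ˣ q) → mk≈ˣ (∙-cong p q)
            }
          ; assoc = λ z w u → mk≈ˣ (assoc (value z) (value w) (value u))
          }
        ; identity = (λ z → mk≈ˣ (identityˡ (value z))) , (λ z → mk≈ˣ (identityʳ (value z)))
        }
      ; inverse = (λ z → mk≈ˣ (trans (comm (inverse z) (value z)) (value*inverse z)))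
                , (λ z → mk≈ˣ (value*inverse z))
      ; ⁻¹-cong = λ {z} {w} (mk≈ˣ z≈w) → mk≈ˣ (trans (sym (identityʳ (inverse z)))
          (trans (∙-congˡ (sym (value*inverse w)))
          (trans (∙-congˡ (∙-congʳ (sym z≈w)))
          (trans (sym (assoc (inverse z) (value z) (inverse w)))
          (trans (∙-congʳ (trans (comm (inverse z) (value z)) (value*inverse z)))
                 (identityˡ (inverse w)))))))
      }
    ; comm = λ z w → mk≈ˣ (comm (value z) (value w))
    }
  }
  where
  open ℂˣ
  open CommutativeMonoid ℂ-*-monoid

1/ᶜ_ : (m : ℕ) → .{{ℕ.NonZero m}} → ℂ
1/ᶜ m = fromℚᶜ (+ 1 ℚ./ m)

-- A polynomial is a formal finite sum of terms; two of them are equal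
-- when all their coefficients agree.
module Polynomial (q : ℕ) where

  Monomial : Set
  Monomial = Vec ℕ q

  Poly : Set
  Poly = List (ℂ × Monomial)

  coeff : Poly → Monomial → ℂ
  coeff []            m = 0ᶜ
  coeff ((z , e) ∷ f) m =
    (if does (≡-dec ℕ._≟_ e m) then z else 0ᶜ) +ᶜ coeff f m

  infix  4 _≈ₚ_
  infixl 6 _+ₚ_
  infixl 7 _*ₚ_

  record _≈ₚ_ (f g : Poly) : Set where
    constructor mk≈ₚ
    field
      coeff-≈ : ∀ m → coeff f m ≈ᶜ coeff g m
  open _≈ₚ_ public

  const : ℂ → Poly
  const z = (z , Vec.replicate q 0) ∷ []

  X : Fin q → Poly
  X i = (1ᶜ , Vec.tabulate λ j → if does (i ≟ᶠ j) then 1 else 0) ∷ []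

  _+ₚ_ _*ₚ_ : Poly → Poly → Poly
  _+ₚ_ = _++_
  _*ₚ_ = cartesianProductWith λ (z , e) (w , f) → z *ᶜ w , Vec.zipWith ℕ._+_ e f

  polyRawSemiring : RawSemiring 0ℓ 0ℓ
  polyRawSemiring = record
    { _≈_ = _≈ₚ_ ; _+_ = _+ₚ_ ; _*_ = _*ₚ_ ; 0# = [] ; 1# = const 1ᶜ }

  open RawSemiringDefs polyRawSemiring public
    using () renaming (sum to sumₚ; product to productₚ; _^_ to _^ₚ_)

record Finite (S : Setoid c ℓ) : Set (c ⊔ ℓ) where
  field
    size        : ℕ
    enumeration : Inverse S (≡.setoid (Fin size))
  open Setoid S
  open Inverse enumeration public using (to; from; to-cong; from-cong)

  from-to : ∀ x → from (to x) ≈ x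
  from-to x = Inverse.inverseʳ enumeration ≡.refl

  to-from : ∀ i → to (from i) ≡ i
  to-from i = Inverse.inverseˡ enumeration refl

  _≟_ : ∀ x y → Dec (x ≈ y)
  x ≟ y = map′
    (λ eq → trans (sym (from-to x)) (trans (from-cong eq) (from-to y)))
    to-cong (to x ≟ᶠ to y)

record Subset (S : Setoid c ℓ) p : Set (c ⊔ ℓ ⊔ lsuc p) where
  open Setoid S
  field
    mem      : Pred Carrier p
    mem?     : Decidable mem
    mem-resp : mem Respects _≈_

infix 4 _∈_

_∈_ : {S : Setoid c ℓ} → Setoid.Carrier S → Subset S p → Set p
x ∈ A = Subset.mem A x

module _ {S : Setoid c ℓ} (fin : Finite S) where
  open Setoid S
  open Finite fin
  open Subset

  elements : Subset S p → List Carrier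
  elements A = filter (mem? A) (map from (allFin size))

  ∣_∣ : Subset S p → ℕ
  ∣ A ∣ = length (elements A)

  ∣_∣-nonZero : (A : Subset S p) → ∃ (_∈ A) → ℕ.NonZero ∣ A ∣
  ∣ A ∣-nonZero (x , x∈A) = nonEmpty (∈-filter⁺ (mem? A)
      (∈-map⁺ from (∈-allFin (to x))) (mem-resp A (sym (from-to x)) x∈A))
    where
    nonEmpty : ∀ {y} {xs : List Carrier} → y ∈ᴸ xs → ℕ.NonZero (length xs)
    nonEmpty {xs = _ ∷ _} _ = _

  image : (f : Carrier → Carrier) → (∀ {x y} → x ≈ y → f x ≈ f y) →
    Subset S p → Subset S (c ⊔ ℓ ⊔ p)
  image f f-cong A = record
    { mem      = λ y → ∃ λ x → x ∈ A × f x ≈ y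
    ; mem?     = λ y → map′
        (λ (i , h) → from i , h)
        (λ (x , x∈A , fx≈y) → to x , mem-resp A (sym (from-to x)) x∈A
                                    , trans (f-cong (from-to x)) fx≈y)
        (any? λ i → mem? A (from i) ×-dec (f (from i) ≟ y))
    ; mem-resp = λ y≈z (x , x∈A , fx≈y) → x , x∈A , trans fx≈y y≈z
    }

module _ (S : Setoid c ℓ) (fin : Finite S) where
  open Finite fin

  vector-finite : ∀ n → Finite (VecEq.≋-setoid S n)
  vector-finite n = record
    { size        = size ℕ.^ n
    ; enumeration = record
      { to        = λ v → funToFin (λ i → to (v i))
      ; from      = λ k i → from (finToFun k i)
      ; to-cong   = λ v≋w → funToFin-cong λ i → to-cong (v≋w i)
      ; from-cong = λ { ≡.refl i → Setoid.refl S }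
      ; inverse   =
          (λ {k} v≋k → ≡.trans
            (funToFin-cong λ i → ≡.trans (to-cong (v≋k i)) (to-from (finToFun k i)))
            (funToFin-finToFin {n} {size} k))
        , (λ { {v} ≡.refl i → Setoid.trans S
            (from-cong (finToFun-funToFin (λ j → to (v j)) i)) (from-to (v i)) })
      }
    }
    where
    funToFin-cong : ∀ {m k} {f g : Fin m → Fin k} → (∀ i → f i ≡ g i) → funToFin f ≡ funToFin g
    funToFin-cong {zero}  eq = ≡.refl
    funToFin-cong {suc m} eq = ≡.cong₂ Fin.combine (eq Fin.zero) (funToFin-cong λ i → eq (Fin.suc i))

permutationSetoid : ℕ → Setoid 0ℓ 0ℓ
permutationSetoid n = record
  { Carrier = Permutation′ n
  ; _≈_ = _≈ₚₑᵣₘ_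
  ; isEquivalence = record
    { refl  = λ _ → ≡.refl
    ; sym   = λ eq i → ≡.sym (eq i)
    ; trans = λ eq eq′ i → ≡.trans (eq i) (eq′ i)
    }
  }

record PermGroup (n : ℕ) : Set where
  open SetoidMembership (permutationSetoid n) using () renaming (_∈_ to _∈ᵖ_)
  field
    perms     : List (Permutation′ n)
    unique    : Unique (permutationSetoid n) perms
    id-mem    : idₚ ∈ᵖ perms
    ∘-closed  : ∀ {g h} → g ∈ᵖ perms → h ∈ᵖ perms → (g ∘ₚ h) ∈ᵖ perms
    ⁻¹-closed : ∀ {g} → g ∈ᵖ perms → flipₚ g ∈ᵖ perms

  order : ℕ
  order = length perms

infix 4 _∈ᴳ_ _≤ᴳ_

_∈ᴳ_ : Permutation′ n → PermGroup n → Set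
_∈ᴳ_ {n} g G = SetoidMembership._∈_ (permutationSetoid n) g (PermGroup.perms G)

_≤ᴳ_ : PermGroup n → PermGroup n → Set
H ≤ᴳ G = ∀ {g} → g ∈ᴳ H → g ∈ᴳ G

module _ (H : PermGroup n) where
  open PermGroup H

  _∈Orbit_ : Fin n → Fin n → Set
  j ∈Orbit i = Any (λ h → h ⟨$⟩ʳ i ≡ j) perms

  _∈Orbit?_ : ∀ j i → Dec (j ∈Orbit i)
  j ∈Orbit? i = anyᴸ? (λ h → (h ⟨$⟩ʳ i) ≟ᶠ j) perms

  -- α 0, …, α (t - 1) represent the distinct orbits
  record Orbits : Set where
    field
      t        : ℕ
      α        : Fin t → Fin n
      cover    : ∀ j → ∃ λ i → j ∈Orbit α i
      disjoint : ∀ {j i k} → j ∈Orbit α i → j ∈Orbit α k → i ≡ k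

    m : Fin t → ℕ
    m i = length (filter (_∈Orbit? α i) (allFin n))

    orbitLength : Fin n → ℕ
    orbitLength j = m (proj₁ (cover j))

module _ (R : Ring c ℓ) where
  open Ring R
  private
    module Uˣ = AbelianGroup ℂˣ-abelianGroup

  record Character : Set (c ⊔ ℓ) where
    field
      ⟦_⟧    : Carrier → ℂˣ
      isHomo : IsGroupHomomorphism +-rawGroup Uˣ.rawGroup ⟦_⟧
    open IsGroupHomomorphism isHomo public using (⟦⟧-cong; homo)
  open Character

  mkCharacter : (f : Carrier → ℂˣ) → (∀ {x y} → x ≈ y → f x Uˣ.≈ f y) →
    (∀ x y → f (x + y) Uˣ.≈ f x Uˣ.∙ f y) → Character
  mkCharacter f f-cong f-homo = record
    { ⟦_⟧    = f
    ; isHomo = record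
      { isMonoidHomomorphism = record
        { isMagmaHomomorphism = record
          { isRelHomomorphism = record { cong = f-cong }
          ; homo              = f-homo
          }
        ; ε-homo = f0
        }
      ; ⁻¹-homo = λ x → GroupProps.inverseˡ-unique Uˣ.group (f (- x)) (f x)
          (Uˣ.trans (Uˣ.sym (f-homo (- x) x)) (Uˣ.trans (f-cong (-‿inverseˡ x)) f0))
      }
    }
    where
    f0 : f 0# Uˣ.≈ Uˣ.ε
    f0 = GroupProps.identityʳ-unique Uˣ.group (f 0#) (f 0#)
      (Uˣ.trans (Uˣ.sym (f-homo 0# 0#)) (f-cong (+-identityˡ 0#)))

  pull : (s : Carrier → Carrier) → (∀ {x y} → x ≈ y → s x ≈ s y) →
    (∀ x y → s (x + y) ≈ s x + s y) → Character → Character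
  pull s s-cong s-homo χ = mkCharacter (λ x → ⟦ χ ⟧ (s x))
    (λ x≈y → ⟦⟧-cong χ (s-cong x≈y))
    (λ x y → Uˣ.trans (⟦⟧-cong χ (s-homo x y)) (homo χ (s x) (s y)))

  _^[_] : Character → Carrier → Character
  χ ^[ r ] = pull (r *_) *-congˡ (distribˡ r) χ

  [_]^_ : Carrier → Character → Character
  [ r ]^ χ = pull (_* r) *-congʳ (distribʳ r) χ

  infix  4 _≈̂_
  infixl 6 _+̂_

  _≈̂_ : Character → Character → Set c
  χ ≈̂ ψ = ∀ x → ⟦ χ ⟧ x Uˣ.≈ ⟦ ψ ⟧ x

  _+̂_ : Character → Character → Character
  χ +̂ ψ = mkCharacter (λ x → ⟦ χ ⟧ x Uˣ.∙ ⟦ ψ ⟧ x)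
    (λ x≈y → Uˣ.∙-cong (⟦⟧-cong χ x≈y) (⟦⟧-cong ψ x≈y))
    (λ x y → Uˣ.trans
      (Uˣ.∙-cong (homo χ x y) (homo ψ x y))
      (interchange (⟦ χ ⟧ x) (⟦ χ ⟧ y) (⟦ ψ ⟧ x) (⟦ ψ ⟧ y)))
    where open CommutativeSemigroupProps Uˣ.commutativeSemigroup using (interchange)

  0̂ : Character
  0̂ = mkCharacter (λ _ → Uˣ.ε) (λ _ → Uˣ.refl) (λ _ _ → Uˣ.sym (Uˣ.identityˡ Uˣ.ε))

  -̂_ : Character → Character
  -̂ χ = mkCharacter (λ x → ⟦ χ ⟧ x Uˣ.⁻¹)
    (λ x≈y → Uˣ.⁻¹-cong (⟦⟧-cong χ x≈y))
    (λ x y → Uˣ.trans (Uˣ.⁻¹-cong (homo χ x y))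
      (Uˣ.sym (AbelianGroupProps.⁻¹-∙-comm ℂˣ-abelianGroup (⟦ χ ⟧ x) (⟦ χ ⟧ y))))

  R̂-right : RawRightModule Carrier (c ⊔ ℓ) c
  R̂-right = record
    { Carrierᴹ = Character ; _≈ᴹ_ = _≈̂_ ; _+ᴹ_ = _+̂_ ; _*ᵣ_ = _^[_] ; 0ᴹ = 0̂ ; -ᴹ_ = -̂_ }

  R̂-left : RawLeftModule Carrier (c ⊔ ℓ) c
  R̂-left = record
    { Carrierᴹ = Character ; _≈ᴹ_ = _≈̂_ ; _+ᴹ_ = _+̂_ ; _*ₗ_ = [_]^_ ; 0ᴹ = 0̂ ; -ᴹ_ = -̂_ }

  IsRightGenerating IsLeftGenerating IsGenerating : Character → Set (c ⊔ ℓ)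
  IsRightGenerating χ = IsRightModuleIsomorphism
    (RightModule.rawRightModule (TensorUnit.rightModule {R = R})) R̂-right (λ r → χ ^[ r ])
  IsLeftGenerating χ = IsLeftModuleIsomorphism
    (LeftModule.rawLeftModule (TensorUnit.leftModule {R = R})) R̂-left (λ r → [ r ]^ χ)
  IsGenerating χ = IsRightGenerating χ ⊎ IsLeftGenerating χ

  -- One-sided ideals, where x ◃ r is x * r (right ideals) or r * x (left
  -- ideals).
  module OneSided (_◃_ : Carrier → Carrier → Carrier)
                  (◃-distrib : ∀ r x y → (x + y) ◃ r ≈ (x ◃ r) + (y ◃ r))
                  (◃-cong : ∀ r {x y} → x ≈ y → x ◃ r ≈ y ◃ r)
                  (◃-zero : ∀ r → 0# ◃ r ≈ 0#)
    where

    record IsIdeal (I : Subset setoid 0ℓ) : Set c where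
      field
        0#-mem   : 0# ∈ I
        +-closed : ∀ {x y} → x ∈ I → y ∈ I → (x + y) ∈ I
        ◃-closed : ∀ {x} r → x ∈ I → (x ◃ r) ∈ I

    _⊆_ : Subset setoid 0ℓ → Subset setoid 0ℓ → Set c
    I ⊆ J = ∀ {x} → x ∈ I → x ∈ J

    IsZero IsWhole : Subset setoid 0ℓ → Set _
    IsZero  I = ∀ x → x ∈ I → x ≈ 0#
    IsWhole I = ∀ x → x ∈ I

    record IsMaximal (I : Subset setoid 0ℓ) : Set (c ⊔ ℓ ⊔ lsuc 0ℓ) where
      field
        isIdeal : IsIdeal I
        proper  : ¬ IsWhole I
        maximal : ∀ J → IsIdeal J → I ⊆ J → J ⊆ I ⊎ IsWhole J

    record IsMinimal (I : Subset setoid 0ℓ) : Set (c ⊔ ℓ ⊔ lsuc 0ℓ) where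
      field
        isIdeal : IsIdeal I
        nonzero : ¬ IsZero I
        minimal : ∀ J → IsIdeal J → J ⊆ I → IsZero J ⊎ I ⊆ J

    -- the sum of the minimal ideals
    data Socle : Carrier → Set (c ⊔ ℓ ⊔ lsuc 0ℓ) where
      empty : ∀ {x} → x ≈ 0# → Socle x
      add  : ∀ {x y z} (I : Subset setoid 0ℓ) → IsMinimal I →
             y ∈ I → Socle z → x ≈ y + z → Socle x

    socle-resp : ∀ {x y} → x ≈ y → Socle x → Socle y
    socle-resp x≈y (empty x≈0)           = empty (trans (sym x≈y) x≈0)
    socle-resp x≈y (add I min y∈I z eq) = add I min y∈I z (trans (sym x≈y) eq)

    socle-+ : ∀ {x y} → Socle x → Socle y → Socle (x + y)
    socle-+ (empty x≈0) sy = socle-resp (sym (trans (+-congʳ x≈0) (+-identityˡ _))) sy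
    socle-+ (add I min y∈I z eq) sy =
      add I min y∈I (socle-+ z sy) (trans (+-congʳ eq) (+-assoc _ _ _))

    socle-◃ : ∀ {x} → Socle x → ∀ r → Socle (x ◃ r)
    socle-◃ (empty x≈0) r = empty (trans (◃-cong r x≈0) (◃-zero r))
    socle-◃ (add I min y∈I z eq) r =
      add I min (IsIdeal.◃-closed (IsMinimal.isIdeal min) r y∈I) (socle-◃ z r)
        (trans (◃-cong r eq) (◃-distrib r _ _))

  module Rightᴵ = OneSided _*_ distribʳ (λ _ → *-congʳ) zeroˡ
  module Leftᴵ  = OneSided (λ x r → r * x) distribˡ (λ _ → *-congˡ) zeroʳ

  -- The intersection of the maximal right ideals is the same two-sided ideal.
  Rad : Carrier → Set (c ⊔ ℓ ⊔ lsuc 0ℓ)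
  Rad x = ∀ I → Leftᴵ.IsMaximal I → x ∈ I

  R/Rad-right : RawRightModule Carrier c (c ⊔ ℓ ⊔ lsuc 0ℓ)
  R/Rad-right = record
    { Carrierᴹ = Carrier ; _≈ᴹ_ = λ x y → Rad (x - y)
    ; _+ᴹ_ = _+_ ; _*ᵣ_ = _*_ ; 0ᴹ = 0# ; -ᴹ_ = -_ }

  R/Rad-left : RawLeftModule Carrier c (c ⊔ ℓ ⊔ lsuc 0ℓ)
  R/Rad-left = record
    { Carrierᴹ = Carrier ; _≈ᴹ_ = λ x y → Rad (x - y)
    ; _+ᴹ_ = _+_ ; _*ₗ_ = _*_ ; 0ᴹ = 0# ; -ᴹ_ = -_ }

  Soc-right : RawRightModule Carrier (c ⊔ ℓ ⊔ lsuc 0ℓ) ℓ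
  Soc-right = record
    { Carrierᴹ = ∃ Socle
    ; _≈ᴹ_ = λ (x , _) (y , _) → x ≈ y
    ; _+ᴹ_ = λ (x , sx) (y , sy) → x + y , socle-+ sx sy
    ; _*ᵣ_ = λ (x , sx) r → x * r , socle-◃ sx r
    ; 0ᴹ   = 0# , empty refl
    ; -ᴹ_  = λ (x , sx) → - x ,
        socle-resp (trans (sym (-‿distribʳ-* x 1#)) (-‿cong (*-identityʳ x))) (socle-◃ sx (- 1#))
    }
    where
    open Rightᴵ
    open RingProps R using (-‿distribʳ-*)

  Soc-left : RawLeftModule Carrier (c ⊔ ℓ ⊔ lsuc 0ℓ) ℓ
  Soc-left = record
    { Carrierᴹ = ∃ Socle
    ; _≈ᴹ_ = λ (x , _) (y , _) → x ≈ y
    ; _+ᴹ_ = λ (x , sx) (y , sy) → x + y , socle-+ sx sy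
    ; _*ₗ_ = λ r (x , sx) → r * x , socle-◃ sx r
    ; 0ᴹ   = 0# , empty refl
    ; -ᴹ_  = λ (x , sx) → - x ,
        socle-resp (trans (sym (-‿distribˡ-* 1# x)) (-‿cong (*-identityˡ x))) (socle-◃ sx (- 1#))
    }
    where
    open Leftᴵ
    open RingProps R using (-‿distribˡ-*)

  IsFrobenius : Set (c ⊔ ℓ ⊔ lsuc 0ℓ)
  IsFrobenius = ∃ (IsRightModuleIsomorphism R/Rad-right Soc-right)
              × ∃ (IsLeftModuleIsomorphism R/Rad-left Soc-left)

module Code (R : Ring c ℓ) (finite : Finite (Ring.setoid R)) (n : ℕ) where
  open Ring R
  open RawMonoidDefs +-rawMonoid using (sum) renaming (_×_ to _×ᴺ_)
  open SumProps +-commutativeMonoid using (sum-cong-≋)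

  V-setoid : Setoid c ℓ
  V-setoid = VecEq.≋-setoid setoid n

  open Setoid V-setoid public using () renaming (Carrier to V; _≈_ to _≋_)

  V-finite : Finite V-setoid
  V-finite = vector-finite setoid finite n

  infixl 7 _·_ _·ᴹ_

  -- Permutations act on positions from the right, i g = g ⟨$⟩ʳ i (so that _∘ₚ_
  -- is the product of the group), and (v · g) i is v at the position i g⁻¹.
  _·_ : V → Permutation′ n → V
  (v · g) i = v (g ⟨$⟩ˡ i)

  ⟨_,_⟩ : V → V → Carrier
  ⟨ u , v ⟩ = sum λ i → u i * v i

  record LeftGCode (G : PermGroup n) p : Set (c ⊔ ℓ ⊔ lsuc p) where
    field
      code      : Subset V-setoid p
      0-mem     : (λ _ → 0#) ∈ code
      +-closed  : ∀ {u v} → u ∈ code → v ∈ code → (λ i → u i + v i) ∈ code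
      *ₗ-closed : ∀ r {v} → v ∈ code → (λ i → r * v i) ∈ code
      G-closed  : ∀ {g v} → g ∈ᴳ G → v ∈ code → (v · g) ∈ code

  _^⊥ : Subset V-setoid p → Subset V-setoid (c ⊔ ℓ ⊔ p)
  C ^⊥ = record
    { mem      = λ u → ∀ v → v ∈ C → ⟨ v , u ⟩ ≈ 0#
    ; mem?     = λ u → map′
        (λ h v v∈C → trans (sum-cong-≋ λ i → *-congʳ (sym (from-to v i)))
          (h (to v) (mem-resp C (λ i → sym (from-to v i)) v∈C)))
        (λ h k → h (from k))
        (all? λ k → mem? C (from k) →-dec (⟨ from k , u ⟩ ≟ᴿ 0#))
    ; mem-resp = λ u≋w h v v∈C → trans (sum-cong-≋ λ i → *-congˡ (sym (u≋w i))) (h v v∈C)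
    }
    where
    open Finite V-finite using (to; from; from-to)
    open Finite finite using () renaming (_≟_ to _≟ᴿ_)
    open Subset

  -- |H| · 1 is a unit of R; a witness contains its inverse.
  OrderInvertible : PermGroup n → Set (c ⊔ ℓ)
  OrderInvertible H = Invertible _≈_ 1# _*_ (PermGroup.order H ×ᴺ 1#)

  module _ (H : PermGroup n) (inv : OrderInvertible H) where
    open PermGroup H

    θ : V → V
    θ v i = proj₁ inv * foldr _+_ 0# (map (λ h → (v · h) i) perms)

    θ-cong : ∀ {u v} → u ≋ v → θ u ≋ θ v
    θ-cong {u} {v} u≋v i = *-congˡ (sum-cong perms)
      where
      sum-cong : ∀ hs → foldr _+_ 0# (map (λ h → (u · h) i) hs)
                      ≈ foldr _+_ 0# (map (λ h → (v · h) i) hs)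
      sum-cong []       = refl
      sum-cong (h ∷ hs) = +-cong (u≋v (h ⟨$⟩ˡ i)) (sum-cong hs)

    imageθ : Subset V-setoid p → Subset V-setoid (c ⊔ ℓ ⊔ p)
    imageθ = image V-finite θ θ-cong

    ∣imageθ∣-nonZero : ∀ {G} (C : LeftGCode G p) →
      ℕ.NonZero (∣_∣ V-finite (imageθ (LeftGCode.code C)))
    ∣imageθ∣-nonZero C = ∣_∣-nonZero V-finite (imageθ code)
      (_ , (λ _ → 0#) , 0-mem , λ _ → refl)
      where open LeftGCode C

  _·ᴹ_ : V → (Fin n → Fin n → Carrier) → V
  (v ·ᴹ A) k = sum λ j → v j * A j k

  module _ {H : PermGroup n} (O : Orbits H) where
    open Orbits O

    orbitLengthMatrix : Fin n → Fin n → Carrier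
    orbitLengthMatrix j k = if does (j ≟ᶠ k) then orbitLength j ×ᴺ 1# else 0#

    imageM : Subset V-setoid p → Subset V-setoid (c ⊔ ℓ ⊔ p)
    imageM = image V-finite (_·ᴹ orbitLengthMatrix)
      λ u≋v k → sum-cong-≋ λ j → *-congʳ (u≋v j)

    open Finite finite using (size; from) renaming (_≟_ to _≟ᴿ_)
    open Polynomial size using (Poly; _+ₚ_; productₚ; _^ₚ_)

    -- A vector u fixed by H is the sum of its entries at the α i times the
    -- indicator vectors of the orbits of the α i.
    count : Carrier → V → ℕ
    count a u = length (filter (λ i → u (α i) ≟ᴿ a) (allFin t))

    cwe : Subset V-setoid p → (Carrier → Poly) → Poly
    cwe D x = foldr _+ₚ_ []
      (map (λ u → productₚ λ a → x (from a) ^ₚ count (from a) u) (elements V-finite D))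

{-# OPTIONS --safe #-}

-- Write u ∈ Vθ_H through its entries u_i on the t orbits. Averaging is self-adjoint
-- and C is stable under H, so for u ∈ Cθ_H the pairing Σ_i u_i w_i vanishes for the
-- coordinates w of every element of (C^⊥)θ_H M_H. Each m_i is a unit, and dividing w
-- by the m_i gives the converse: (C^⊥)θ_H M_H is the right dual of Cθ_H in R^t. The
-- rest is MacWilliams' argument. Expanding the product over the orbits gives
-- Σ_w (Σ_u χ(Σ_i u_i w_i)) Π_i x_{w_i}, and the inner sum over u ∈ Cθ_H is ∣Cθ_H∣ if w
-- is in the dual. Otherwise it is 0, since the kernel of a generating character
-- contains no nonzero left ideal.
--
-- Equality of complex numbers is undecidable here. A character sum s satisfies
-- χ(a) s = s for all a, so if s were apart from 0 the character would be trivial.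
-- Hence s is not apart from 0, and that already makes it equal to 0.
module Submission where

open import Algebra.Bundles
  using (Ring; CommutativeRing; Semiring; CommutativeSemiring; CommutativeMonoid; Group)
import Algebra.Definitions.RawMonoid as RawMonoidDefs
open import Algebra.Module.Morphism.Structures
  using (module IsLeftModuleIsomorphism; module IsRightModuleIsomorphism)
open import Algebra.Morphism.Structures using (module GroupMorphisms)
open GroupMorphisms using (module IsGroupHomomorphism)
import Algebra.Properties.CommutativeMonoid.Sum as SumProps
import Algebra.Properties.CommutativeSemigroup as CommutativeSemigroupProps
import Algebra.Properties.Group as GroupProps
import Algebra.Properties.Monoid.Mult as MultProps
import Algebra.Properties.Ring as RingProps
import Algebra.Properties.Semiring.Mult as SemiringMult
import Algebra.Properties.Semiring.Sum as SemiringSum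
open import Data.Bool.Base using (if_then_else_; true; false)
open import Data.Empty using (⊥-elim)
open import Data.Fin.Base using (Fin; zero; suc; _↑ˡ_; _↑ʳ_; combine; finToFun)
open import Data.Fin.Permutation
  using (Permutation′; _⟨$⟩ʳ_; _⟨$⟩ˡ_; _∘ₚ_; inverseˡ; inverseʳ)
  renaming (_≈_ to _≈ₚₑᵣₘ_; id to idₚ; flip to flipₚ)
open import Data.Fin.Properties using (all?; remQuot-combine) renaming (_≟_ to _≟ᶠ_)
open import Data.Integer.Base as ℤ using (+_)
import Data.Integer.Properties as ℤ
open import Data.List.Base
  using (List; []; _∷_; _++_; map; foldr; filter; length; allFin; tabulate; deduplicate)
open import Data.List.Membership.Propositional using (find) renaming (_∈_ to _∈ᴸ_)
open import Data.List.Membership.Propositional.Properties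
  using (∈-allFin; ∈-deduplicate⁺; ∈-++⁺ˡ; ∈-++⁺ʳ)
import Data.List.Membership.Setoid as SetoidMembership
import Data.List.Membership.Setoid.Properties as SetoidMembershipProps
open import Data.List.Properties using (map-∘)
open import Data.List.Relation.Unary.All using (All; []; _∷_)
open import Data.List.Relation.Unary.All.Properties using (All¬⇒¬Any)
open import Data.List.Relation.Unary.AllPairs using (_∷_)
open import Data.List.Relation.Unary.Any as Any using (here; there)
open import Data.List.Relation.Unary.Unique.DecPropositional.Properties using (deduplicate-!)
open import Data.List.Relation.Unary.Unique.Propositional using () renaming (Unique to Unique≡)
open import Data.List.Relation.Unary.Unique.Propositional.Properties using (allFin⁺)
open import Data.List.Relation.Unary.Unique.Setoid using (Unique)
import Data.List.Relation.Unary.Unique.Setoid.Properties as Unique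
open import Data.Nat.Base as ℕ using (ℕ; zero; suc)
import Data.Nat.Properties as ℕ
open import Data.Product.Base using (∃; _×_; _,_; proj₁; proj₂)
open import Data.Rational.Base as ℚ using (ℚ; 0ℚ; 1ℚ; ½)
import Data.Rational.Properties as ℚ
open import Data.Rational.Solver using (module +-*-Solver)
import Data.Rational.Unnormalised.Base as ℚᵘ
import Data.Rational.Unnormalised.Properties as ℚᵘ
open import Data.Sum.Base using (inj₁; inj₂)
open import Data.Unit.Polymorphic.Base using (⊤; tt)
open import Data.Vec.Base as Vec using (Vec)
open import Data.Vec.Properties using (≡-dec; zipWith-assoc; zipWith-comm; zipWith-identityˡ)
open import Function.Base using (_∘_; id)
open import Level using (Level; 0ℓ; _⊔_)
open import Relation.Binary.Bundles using (Setoid)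
import Relation.Binary.PropositionalEquality as ≡
open ≡ using (_≡_)
import Relation.Binary.Reasoning.Setoid as SetoidReasoning
open import Relation.Nullary using (¬_; Dec; yes; no; does; contradiction)
open import Relation.Nullary.Decidable using (¬?)
open import Relation.Unary using (Pred; Decidable)
open import Defs

private variable
  c ℓ p : Level
  n : ℕ

-- The kernel condition has a side. For fixed w the values Σ_i u_i w_i with u in Cθ_H are closed
-- under left multiplication, so the ideals to be excluded from the kernel of χ are the left ideals
-- R a. A left generating character excludes them directly, whereas a right generating one excludes
-- the right ideals a R. The passage from one side to the other is a double count of the sums of χ(r
-- y) over all r and y in R. That count would naturally read off which of two values each sum takes,
-- and this cannot be decided in ℂ. It is therefore run as a refutation of a ≠ 0: the values are
-- natural numbers up to double negation, which is enough to derive a contradiction, and since R is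
-- finite its equality is decidable, so the refutation yields a = 0.

module ℂᴿ = CommutativeRing ℂ-commutativeRing

-- Apartness, cancellation and natural numbers in ℂ.

module ComplexNumbers where
  open RationalBounds

  private
    -0ᵠ : ∀ p → p ℚ.- 0ℚ ≡ p
    -0ᵠ = solve 1 (λ p → p :- con 0ℚ := p) ≡.refl
      where open +-*-Solver

  -- Nonzero in the positive sense: the bound δ is data that a cancellation can divide by, which a
  -- mere negation of equality would not supply.
  Apartʳ : ℝ → Set
  Apartʳ x = ∃ λ δ → 0ℚ ℚ.< δ × ∃ λ N → ∀ n → N ℕ.≤ n → δ ℚ.≤ ℚ.∣ seq x n ∣

  -- Comparing rationals is decidable, so one late term x_K is compared with ε/2. If it is smaller,
  -- the Cauchy property keeps all later terms below ε. If not, terms that stay within ε/4 of x_K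
  -- are at least ε/4 in absolute value, which makes x apart from 0.
  ¬apartʳ⇒≈0 : ∀ {x} → ¬ Apartʳ x → x ≈ʳ fromℚ 0ℚ
  ¬apartʳ⇒≈0 {x} ¬apart = mk≈ʳ small
    where
    open ℚ.≤-Reasoning
    small : ∀ ε → 0ℚ ℚ.< ε → ∃ λ N → ∀ n → N ℕ.≤ n → ℚ.∣ seq x n ℚ.- 0ℚ ∣ ℚ.< ε
    small ε ε>0 with cauchy x _ (0<½* ε ε>0) | cauchy x _ (0<½* _ (0<½* ε ε>0))
    ... | M , hM | N , hN with ℚ.∣ seq x (M ℕ.⊔ N) ∣ ℚ.<? ½ ℚ.* ε
    ...   | yes small = K , λ n K≤n → ∣-∣-add ε (seq x K) (seq x n ℚ.- seq x K) _
              (≡.trans (-0ᵠ (seq x n)) (self-split (seq x K) (seq x n))) small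
              (hM n K (ℕ.≤-trans (ℕ.m≤m⊔n M N) K≤n) (ℕ.m≤m⊔n M N))
      where K = M ℕ.⊔ N
    ...   | no large = contradiction apart ¬apart
      where
      K = M ℕ.⊔ N
      apart : Apartʳ x
      apart = ½ ℚ.* (½ ℚ.* ε) , 0<½* _ (0<½* ε ε>0) , K , λ n K≤n → ℚ.≮⇒≥ λ xn<δ →
        large (∣-∣-add (½ ℚ.* ε) (seq x n) (seq x K ℚ.- seq x n) (seq x K)
          (self-split (seq x n) (seq x K)) xn<δ
          (hN K n (ℕ.m≤n⊔m M N) (ℕ.≤-trans (ℕ.m≤n⊔m M N) K≤n)))

  private
    ≤∣∣⇒*≤ : ∀ {δ ε} → 0ℚ ℚ.< δ → 0ℚ ℚ.< ε → ∀ p q → δ ℚ.≤ ℚ.∣ p ∣ → ε ℚ.≤ ℚ.∣ q ∣ →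
      δ ℚ.* ε ℚ.≤ ℚ.∣ p ℚ.* q ∣
    ≤∣∣⇒*≤ {δ} {ε} δ>0 ε>0 p q δ≤ ε≤ = begin
      δ ℚ.* ε                 ≤⟨ ℚ.*-monoʳ-≤-nonNeg ε {{ℚ.nonNegative (ℚ.<⇒≤ ε>0)}} δ≤ ⟩
      ℚ.∣ p ∣ ℚ.* ε           ≤⟨ ℚ.*-monoˡ-≤-nonNeg ℚ.∣ p ∣ {{ℚ.nonNegative (ℚ.0≤∣p∣ p)}} ε≤ ⟩
      ℚ.∣ p ∣ ℚ.* ℚ.∣ q ∣     ≡⟨ ℚ.∣p*q∣≡∣p∣*∣q∣ p q ⟨
      ℚ.∣ p ℚ.* q ∣           ∎
      where open ℚ.≤-Reasoning

    0<* : ∀ {δ ε} → 0ℚ ℚ.< δ → 0ℚ ℚ.< ε → 0ℚ ℚ.< δ ℚ.* ε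
    0<* {δ} {ε} δ>0 ε>0 = ℚ.positive⁻¹ _
      {{ℚ.pos*pos⇒pos δ {{ℚ.positive δ>0}} ε {{ℚ.positive ε>0}}}}

    0≤p² : ∀ p → 0ℚ ℚ.≤ p ℚ.* p
    0≤p² p with ℚ.≤-total 0ℚ p
    ... | inj₁ 0≤p = ℚ.nonNegative⁻¹ _
          {{ℚ.nonNeg*nonNeg⇒nonNeg p {{ℚ.nonNegative 0≤p}} p {{ℚ.nonNegative 0≤p}}}}
    ... | inj₂ p≤0 = ℚ.nonNegative⁻¹ _
          {{ℚ.nonPos*nonPos⇒nonPos p {{ℚ.nonPositive p≤0}} p {{ℚ.nonPositive p≤0}}}}

    <⇒≱ : ∀ {p q} → p ℚ.< q → ¬ q ℚ.≤ p
    <⇒≱ p<q q≤p = ℚ.<-irrefl ≡.refl (ℚ.<-≤-trans p<q q≤p)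

    *-+-posˡ : ∀ p q → ℚ.∣ p ℚ.* p ∣ ℚ.≤ ℚ.∣ p ℚ.* p ℚ.+ q ℚ.* q ∣
    *-+-posˡ p q = begin
      ℚ.∣ p ℚ.* p ∣               ≡⟨ ℚ.0≤p⇒∣p∣≡p (0≤p² p) ⟩
      p ℚ.* p                     ≡⟨ ℚ.+-identityʳ _ ⟨
      p ℚ.* p ℚ.+ 0ℚ              ≤⟨ ℚ.+-monoʳ-≤ (p ℚ.* p) (0≤p² q) ⟩
      p ℚ.* p ℚ.+ q ℚ.* q         ≡⟨ ℚ.0≤p⇒∣p∣≡p (ℚ.+-mono-≤ (0≤p² p) (0≤p² q)) ⟨
      ℚ.∣ p ℚ.* p ℚ.+ q ℚ.* q ∣   ∎
      where open ℚ.≤-Reasoning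

  opaque
    unfolding _+ʳ_ -ʳ_ _*ʳ_

    -- No inverse of x is constructed: a late term of y of size at least ε would make the product at
    -- least δ ε, and the product is eventually smaller than that.
    apartʳ-cancel : ∀ {x y} → Apartʳ x → x *ʳ y ≈ʳ fromℚ 0ℚ → y ≈ʳ fromℚ 0ℚ
    apartʳ-cancel {x} {y} (δ , δ>0 , M , hM) (mk≈ʳ xy≈0) = mk≈ʳ small
      where
      small : ∀ ε → 0ℚ ℚ.< ε → ∃ λ N → ∀ n → N ℕ.≤ n → ℚ.∣ seq y n ℚ.- 0ℚ ∣ ℚ.< ε
      small ε ε>0 with xy≈0 (δ ℚ.* ε) (0<* δ>0 ε>0)
      ... | N , hN = M ℕ.⊔ N , λ n MN≤n → ℚ.≰⇒> λ ε≤ → <⇒≱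
        (hN n (ℕ.≤-trans (ℕ.m≤n⊔m M N) MN≤n))
        (≡.subst (λ p → δ ℚ.* ε ℚ.≤ ℚ.∣ p ∣) (≡.sym (-0ᵠ _))
          (≤∣∣⇒*≤ δ>0 ε>0 (seq x n) (seq y n) (hM n (ℕ.≤-trans (ℕ.m≤m⊔n M N) MN≤n))
            (≡.subst (λ p → ε ℚ.≤ ℚ.∣ p ∣) (-0ᵠ _) ε≤)))

    squares≈0 : ∀ {x y} → x *ʳ x +ʳ y *ʳ y ≈ʳ fromℚ 0ℚ → x ≈ʳ fromℚ 0ℚ
    squares≈0 {x} {y} (mk≈ʳ x²+y²≈0) = mk≈ʳ small
      where
      small : ∀ ε → 0ℚ ℚ.< ε → ∃ λ N → ∀ n → N ℕ.≤ n → ℚ.∣ seq x n ℚ.- 0ℚ ∣ ℚ.< ε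
      small ε ε>0 with x²+y²≈0 (ε ℚ.* ε) (0<* ε>0 ε>0)
      ... | N , hN = N , λ n N≤n → ℚ.≰⇒> λ ε≤ →
        let ε≤x = ≡.subst (λ p → ε ℚ.≤ ℚ.∣ p ∣) (-0ᵠ _) ε≤ in
        <⇒≱ (hN n N≤n) (≡.subst (λ p → ε ℚ.* ε ℚ.≤ ℚ.∣ p ∣) (≡.sym (-0ᵠ _))
          (ℚ.≤-trans (≤∣∣⇒*≤ ε>0 ε>0 (seq x n) (seq x n) ε≤x ε≤x)
            (*-+-posˡ (seq x n) (seq y n))))

    -- The components of ∣z∣² w = z̄ (z w), for z = a + b i and w = c + d i.
    norm²*re : ∀ a b c d → (a *ʳ a +ʳ b *ʳ b) *ʳ c ≈ʳ
      a *ʳ (a *ʳ c -ʳ b *ʳ d) +ʳ b *ʳ (a *ʳ d +ʳ b *ʳ c)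
    norm²*re a b c d = pointwise λ n → solve 4 (λ a b c d →
      (a :* a :+ b :* b) :* c :=
      a :* (a :* c :+ :- (b :* d)) :+ b :* (a :* d :+ b :* c)) ≡.refl
      (seq a n) (seq b n) (seq c n) (seq d n)
      where open +-*-Solver

    norm²*im : ∀ a b c d → (a *ʳ a +ʳ b *ʳ b) *ʳ d ≈ʳ
      a *ʳ (a *ʳ d +ʳ b *ʳ c) -ʳ b *ʳ (a *ʳ c -ʳ b *ʳ d)
    norm²*im a b c d = pointwise λ n → solve 4 (λ a b c d →
      (a :* a :+ b :* b) :* d :=
      a :* (a :* d :+ b :* c) :+ :- (b :* (a :* c :+ :- (b :* d)))) ≡.refl
      (seq a n) (seq b n) (seq c n) (seq d n)
      where open +-*-Solver

    *0+*0 : ∀ a b → a *ʳ fromℚ 0ℚ +ʳ b *ʳ fromℚ 0ℚ ≈ʳ fromℚ 0ℚ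
    *0+*0 a b = pointwise λ n → solve 2 (λ a b →
      a :* con 0ℚ :+ b :* con 0ℚ := con 0ℚ) ≡.refl (seq a n) (seq b n)
      where open +-*-Solver

    *0-*0 : ∀ a b → a *ʳ fromℚ 0ℚ -ʳ b *ʳ fromℚ 0ℚ ≈ʳ fromℚ 0ℚ
    *0-*0 a b = pointwise λ n → solve 2 (λ a b →
      a :* con 0ℚ :+ :- (b :* con 0ℚ) := con 0ℚ) ≡.refl (seq a n) (seq b n)
      where open +-*-Solver

    fromℚ-+ : ∀ p q → fromℚ p +ʳ fromℚ q ≈ʳ fromℚ (p ℚ.+ q)
    fromℚ-+ p q = pointwise λ _ → ≡.refl

    fromℚ-*-re : ∀ p q → fromℚ p *ʳ fromℚ q -ʳ fromℚ 0ℚ *ʳ fromℚ 0ℚ ≈ʳ fromℚ (p ℚ.* q)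
    fromℚ-*-re p q = pointwise λ _ → ℚ.+-identityʳ (p ℚ.* q)

    fromℚ-*-im : ∀ p q → fromℚ p *ʳ fromℚ 0ℚ +ʳ fromℚ 0ℚ *ʳ fromℚ q ≈ʳ fromℚ 0ℚ
    fromℚ-*-im p q = pointwise λ _ → solve 2 (λ p q →
      p :* con 0ℚ :+ con 0ℚ :* q := con 0ℚ) ≡.refl p q
      where open +-*-Solver

  -- Stated through ∣z∣², a single real number, so that no choice between the real and the imaginary
  -- part is involved.
  Apart : ℂ → Set
  Apart z = Apartʳ (re z *ʳ re z +ʳ im z *ʳ im z)

  ¬apart⇒≈0 : ∀ {z} → ¬ Apart z → z ≈ᶜ 0ᶜ
  ¬apart⇒≈0 {z} ¬apart = mk≈ᶜ (squares≈0 norm²≈0)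
    (squares≈0 (≈ʳ-trans (ComplexLaws.+-commʳ (im z *ʳ im z) (re z *ʳ re z)) norm²≈0))
    where
    norm²≈0 : re z *ʳ re z +ʳ im z *ʳ im z ≈ʳ fromℚ 0ℚ
    norm²≈0 = ¬apartʳ⇒≈0 ¬apart

  -- Multiplying z w = 0 by the conjugate of z leaves ∣z∣² w = 0, and the real factor cancels from
  -- each component.
  apart-cancel : ∀ {z w} → Apart z → z *ᶜ w ≈ᶜ 0ᶜ → w ≈ᶜ 0ᶜ
  apart-cancel {a +i b} {c +i d} apart (mk≈ᶜ re≈0 im≈0) = mk≈ᶜ
    (apartʳ-cancel apart (≈ʳ-trans (norm²*re a b c d)
      (≈ʳ-trans (+ʳ-cong (*ʳ-cong ≈ʳ-refl re≈0) (*ʳ-cong ≈ʳ-refl im≈0)) (*0+*0 a b))))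
    (apartʳ-cancel apart (≈ʳ-trans (norm²*im a b c d)
      (≈ʳ-trans (+ʳ-cong (*ʳ-cong ≈ʳ-refl im≈0) (-ʳ-cong (*ʳ-cong ≈ʳ-refl re≈0))) (*0-*0 a b))))

  open RawMonoidDefs ℂᴿ.+-rawMonoid using () renaming (_×_ to _×ᶜ_)
  open RingProps ℂᴿ.ring using (+-cancelˡ)
  open SetoidReasoning ℂᴿ.setoid

  fromℚᶜ-cong : ∀ {p q} → p ≡ q → fromℚᶜ p ≈ᶜ fromℚᶜ q
  fromℚᶜ-cong ≡.refl = ℂᴿ.refl

  fromℚᶜ-+ : ∀ p q → fromℚᶜ p +ᶜ fromℚᶜ q ≈ᶜ fromℚᶜ (p ℚ.+ q)
  fromℚᶜ-+ p q = mk≈ᶜ (fromℚ-+ p q) (fromℚ-+ 0ℚ 0ℚ)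

  fromℚᶜ-* : ∀ p q → fromℚᶜ p *ᶜ fromℚᶜ q ≈ᶜ fromℚᶜ (p ℚ.* q)
  fromℚᶜ-* p q = mk≈ᶜ (fromℚ-*-re p q) (fromℚ-*-im p q)

  -- Sums of n ones come from character sums, while `1/ᶜ` is an embedded rational; this connects the
  -- two forms.
  ×1ᶜ≈fromℚᶜ : ∀ n → n ×ᶜ 1ᶜ ≈ᶜ fromℚᶜ (+ n ℚ./ 1)
  ×1ᶜ≈fromℚᶜ zero    = ℂᴿ.refl
  ×1ᶜ≈fromℚᶜ (suc n) = begin
    1ᶜ +ᶜ n ×ᶜ 1ᶜ                       ≈⟨ ℂᴿ.+-congˡ (×1ᶜ≈fromℚᶜ n) ⟩
    1ᶜ +ᶜ fromℚᶜ (+ n ℚ./ 1)            ≈⟨ fromℚᶜ-+ 1ℚ (+ n ℚ./ 1) ⟩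
    fromℚᶜ (1ℚ ℚ.+ + n ℚ./ 1)           ≈⟨ fromℚᶜ-cong (suc/1 n) ⟩
    fromℚᶜ (+ suc n ℚ./ 1)              ∎
    where
    -- Reduction to lowest terms does not compute for a variable n, so the equation is checked on
    -- unnormalised fractions, where it is an integer cross-multiplication.
    suc/1 : ∀ n → 1ℚ ℚ.+ + n ℚ./ 1 ≡ + suc n ℚ./ 1
    suc/1 n = ℚ.toℚᵘ-injective (ℚᵘ.≃-trans (ℚ.toℚᵘ-homo-+ 1ℚ (+ n ℚ./ 1))
        (ℚᵘ.≃-trans (ℚᵘ.+-congʳ ℚᵘ.1ℚᵘ (ℚ.toℚᵘ-fromℚᵘ (+ n ℚᵘ./ 1)))
          (ℚᵘ.≃-trans (ℚᵘ.*≡* (≡.cong (λ k → (+ 1 ℤ.+ k) ℤ.* + 1) (ℤ.*-identityʳ (+ n))))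
            (ℚᵘ.≃-sym (ℚ.toℚᵘ-fromℚᵘ (+ suc n ℚᵘ./ 1))))))

  1/ᶜ*× : ∀ m .{{_ : ℕ.NonZero m}} → (1/ᶜ m) *ᶜ m ×ᶜ 1ᶜ ≈ᶜ 1ᶜ
  1/ᶜ*× m = begin
    (1/ᶜ m) *ᶜ m ×ᶜ 1ᶜ               ≈⟨ ℂᴿ.*-congˡ (×1ᶜ≈fromℚᶜ m) ⟩
    (1/ᶜ m) *ᶜ fromℚᶜ (+ m ℚ./ 1)    ≈⟨ fromℚᶜ-* (+ 1 ℚ./ m) (+ m ℚ./ 1) ⟩
    fromℚᶜ (+ 1 ℚ./ m ℚ.* (+ m ℚ./ 1)) ≈⟨ fromℚᶜ-cong (1/m*m m) ⟩
    1ᶜ                               ∎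
    where
    1/m*m : ∀ m .{{_ : ℕ.NonZero m}} → + 1 ℚ./ m ℚ.* (+ m ℚ./ 1) ≡ 1ℚ
    1/m*m m@(suc _) = ℚ.toℚᵘ-injective (ℚᵘ.≃-trans (ℚ.toℚᵘ-homo-* (+ 1 ℚ./ m) (+ m ℚ./ 1))
      (ℚᵘ.≃-trans (ℚᵘ.*-cong (ℚ.toℚᵘ-fromℚᵘ (+ 1 ℚᵘ./ m)) (ℚ.toℚᵘ-fromℚᵘ (+ m ℚᵘ./ 1)))
        (ℚᵘ.*≡* (ℤ.*-assoc (+ 1) (+ m) (+ 1)))))

  1≉0 : ¬ 1ᶜ ≈ᶜ 0ᶜ
  1≉0 (mk≈ᶜ (mk≈ʳ 1≈0) _) with 1≈0 1ℚ (ℚ.positive⁻¹ 1ℚ)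
  ... | N , h = ℚ.<-irrefl ≡.refl (h N ℕ.≤-refl)

  ×1ᶜ≈0⇒≡0 : ∀ n → n ×ᶜ 1ᶜ ≈ᶜ 0ᶜ → n ≡ 0
  ×1ᶜ≈0⇒≡0 zero      _    = ≡.refl
  ×1ᶜ≈0⇒≡0 m@(suc _) m≈0 = contradiction
    (ℂᴿ.trans (ℂᴿ.sym (1/ᶜ*× m)) (ℂᴿ.trans (ℂᴿ.*-congˡ m≈0) (ℂᴿ.zeroʳ _))) 1≉0

  -- Characteristic 0: it turns two evaluations of the same character sum into an equation in ℕ.
  ×1ᶜ-injective : ∀ {m n} → m ×ᶜ 1ᶜ ≈ᶜ n ×ᶜ 1ᶜ → m ≡ n
  ×1ᶜ-injective {zero}  {n}     eq = ≡.sym (×1ᶜ≈0⇒≡0 n (ℂᴿ.sym eq))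
  ×1ᶜ-injective {suc m} {zero}  eq = ×1ᶜ≈0⇒≡0 (suc m) eq
  ×1ᶜ-injective {suc m} {suc n} eq = ≡.cong suc (×1ᶜ-injective (+-cancelˡ _ _ _ eq))

open ComplexNumbers

-- Finite sums and products over lists.

module ListSum {c ℓ} (M : CommutativeMonoid c ℓ) where
  open CommutativeMonoid M
  open CommutativeSemigroupProps commutativeSemigroup using (interchange)
  open RawMonoidDefs rawMonoid using (sum) renaming (_×_ to _×ᴺ_)
  open SumProps M using (sum-cong-≋; ∑-distrib-+; sum-replicate-zero)
  open SetoidReasoning setoid

  ∑ : ∀ {a} {A : Set a} → (A → Carrier) → List A → Carrier
  ∑ f xs = foldr _∙_ ε (map f xs)

  -- The Iverson bracket; in a multiplicative monoid its default value is 1.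
  [_]_ : ∀ {p} {P : Set p} → Dec P → Carrier → Carrier
  [ P? ] z = if does P? then z else ε

  []-yes : ∀ {p} {P : Set p} (P? : Dec P) → P → ∀ z → [ P? ] z ≈ z
  []-yes (yes _) _ z = refl
  []-yes (no ¬p) p z = contradiction p ¬p

  []-no : ∀ {p} {P : Set p} (P? : Dec P) → ¬ P → ∀ z → [ P? ] z ≈ ε
  []-no (yes p) ¬p z = contradiction p ¬p
  []-no (no _)  _  z = refl

  []-⇔ : ∀ {p q} {P : Set p} {Q : Set q} (P? : Dec P) (Q? : Dec Q) →
    (P → Q) → (Q → P) → ∀ z → [ P? ] z ≈ [ Q? ] z
  []-⇔ (yes p) Q? P⇒Q Q⇒P z = sym ([]-yes Q? (P⇒Q p) z)
  []-⇔ (no ¬p) Q? P⇒Q Q⇒P z = sym ([]-no Q? (¬p ∘ Q⇒P) z)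

  module _ {a} {A : Set a} where

    ∑-cong-∈ : ∀ {f g : A → Carrier} xs → (∀ {x} → x ∈ᴸ xs → f x ≈ g x) → ∑ f xs ≈ ∑ g xs
    ∑-cong-∈ []       f≈g = refl
    ∑-cong-∈ (x ∷ xs) f≈g = ∙-cong (f≈g (here ≡.refl)) (∑-cong-∈ xs (f≈g ∘ there))

    ∑-cong : ∀ {f g : A → Carrier} xs → (∀ x → f x ≈ g x) → ∑ f xs ≈ ∑ g xs
    ∑-cong xs f≈g = ∑-cong-∈ xs λ {x} _ → f≈g x

    ∑-ε : ∀ (xs : List A) → ∑ (λ _ → ε) xs ≈ ε
    ∑-ε []       = refl
    ∑-ε (x ∷ xs) = trans (identityˡ _) (∑-ε xs)

    ∑-∙ : ∀ (f g : A → Carrier) xs → ∑ (λ x → f x ∙ g x) xs ≈ ∑ f xs ∙ ∑ g xs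
    ∑-∙ f g []       = sym (identityˡ ε)
    ∑-∙ f g (x ∷ xs) = trans (∙-congˡ (∑-∙ f g xs)) (interchange (f x) (g x) _ _)

    ∑-const : ∀ z (xs : List A) → ∑ (λ _ → z) xs ≈ length xs ×ᴺ z
    ∑-const z []       = refl
    ∑-const z (x ∷ xs) = ∙-congˡ (∑-const z xs)

    ∑-filter : ∀ {p} {P : Pred A p} (P? : Decidable P) (f : A → Carrier) xs →
      ∑ f (filter P? xs) ≈ ∑ (λ x → [ P? x ] f x) xs
    ∑-filter P? f []       = refl
    ∑-filter P? f (x ∷ xs) with does (P? x)
    ... | true  = ∙-congˡ (∑-filter P? f xs)
    ... | false = trans (∑-filter P? f xs) (sym (identityˡ _))

  ∑-comm : ∀ {a b} {A : Set a} {B : Set b} (f : A → B → Carrier) xs ys →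
    ∑ (λ x → ∑ (f x) ys) xs ≈ ∑ (λ y → ∑ (λ x → f x y) xs) ys
  ∑-comm f []       ys = sym (∑-ε ys)
  ∑-comm f (x ∷ xs) ys = trans (∙-congˡ (∑-comm f xs ys)) (sym (∑-∙ (f x) _ ys))

  ∑-map : ∀ {a b} {A : Set a} {B : Set b} (f : B → Carrier) (g : A → B) xs →
    ∑ f (map g xs) ≡ ∑ (f ∘ g) xs
  ∑-map f g xs = ≡.cong (foldr _∙_ ε) (≡.sym (map-∘ xs))

  ∑-tabulate : ∀ {a} {A : Set a} (f : A → Carrier) {n} (g : Fin n → A) →
    ∑ f (tabulate g) ≈ sum (f ∘ g)
  ∑-tabulate f {zero}  g = refl
  ∑-tabulate f {suc n} g = ∙-congˡ (∑-tabulate f (g ∘ suc))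

  ∑-allFin : ∀ n (f : Fin n → Carrier) → ∑ f (allFin n) ≈ sum f
  ∑-allFin n f = ∑-tabulate f id

  module _ {s t} (S : Setoid s t) (_≟_ : ∀ x y → Dec (Setoid._≈_ S x y)) where
    open Setoid S using () renaming (_≈_ to _≈ₛ_; sym to symₛ; trans to transₛ)
    open SetoidMembership S using () renaming (_∈_ to _∈ₛ_)

    ∑-delta : ∀ {x xs} (f : Setoid.Carrier S → Carrier) → (∀ {y} → x ≈ₛ y → f x ≈ f y) →
      Unique S xs → x ∈ₛ xs → ∑ (λ y → [ x ≟ y ] f y) xs ≈ f x
    ∑-delta {x} {y ∷ xs} f f-cong (y≉xs ∷ _) (here x≈y) = begin
      [ x ≟ y ] f y ∙ ∑ (λ y → [ x ≟ y ] f y) xs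
        ≈⟨ ∙-cong ([]-yes (x ≟ y) x≈y (f y)) (trans (rest y≉xs) (∑-ε xs)) ⟩
      f y ∙ ε   ≈⟨ identityʳ (f y) ⟩
      f y       ≈⟨ f-cong x≈y ⟨
      f x       ∎
      where
      rest : ∀ {xs} → All (λ z → ¬ y ≈ₛ z) xs → ∑ (λ y → [ x ≟ y ] f y) xs ≈ ∑ (λ _ → ε) xs
      rest []         = refl
      rest (y≉z ∷ zs) = ∙-cong ([]-no (x ≟ _) (λ x≈z → y≉z (transₛ (symₛ x≈y) x≈z)) _) (rest zs)
    ∑-delta {x} {y ∷ xs} f f-cong (y≉xs ∷ xs!) (there x∈xs) = begin
      [ x ≟ y ] f y ∙ ∑ (λ y → [ x ≟ y ] f y) xs
        ≈⟨ ∙-cong ([]-no (x ≟ y) (λ x≈y → All¬⇒¬Any y≉xs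
             (Any.map (transₛ (symₛ x≈y)) x∈xs)) (f y)) (∑-delta f f-cong xs! x∈xs) ⟩
      ε ∙ f x   ≈⟨ identityˡ (f x) ⟩
      f x       ∎

  sum-delta : ∀ {n} (i : Fin n) (f : Fin n → Carrier) → sum (λ j → [ i ≟ᶠ j ] f j) ≈ f i
  sum-delta {n} i f = trans (sym (∑-allFin n _))
    (∑-delta (≡.setoid (Fin n)) _≟ᶠ_ f (λ { ≡.refl → refl }) (allFin⁺ n) (∈-allFin i))

  module _ {s s′ t t′} (S : Setoid s s′) (T : Setoid t t′)
    (_≟ₛ_ : ∀ x y → Dec (Setoid._≈_ S x y)) (_≟ₜ_ : ∀ x y → Dec (Setoid._≈_ T x y))
    where
    open Setoid S using () renaming (_≈_ to _≈ₛ_; sym to symₛ; trans to transₛ)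
    open Setoid T using () renaming (_≈_ to _≈ₜ_; sym to symₜ; trans to transₜ)
    open SetoidMembership S using () renaming (_∈_ to _∈ₛ_)
    open SetoidMembership T using () renaming (_∈_ to _∈ₜ_)

    -- Both sides are Σₓ Σ_y [ p x ≈ y ] f y.
    ∑-reindex : ∀ {xs ys} → Unique S xs → Unique T ys →
      (p : Setoid.Carrier S → Setoid.Carrier T) (r : Setoid.Carrier T → Setoid.Carrier S) →
      (∀ {x y} → x ≈ₛ y → p x ≈ₜ p y) → (∀ {x y} → x ≈ₜ y → r x ≈ₛ r y) →
      (∀ {x} → x ∈ₛ xs → p x ∈ₜ ys) → (∀ {y} → y ∈ₜ ys → r y ∈ₛ xs) →
      (∀ {x} → x ∈ₛ xs → r (p x) ≈ₛ x) → (∀ {y} → y ∈ₜ ys → p (r y) ≈ₜ y) →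
      (f : Setoid.Carrier T → Carrier) → (∀ {x y} → x ≈ₜ y → f x ≈ f y) →
      ∑ (f ∘ p) xs ≈ ∑ f ys
    ∑-reindex {xs} {ys} xs! ys! p r p-cong r-cong p∈ r∈ r∘p p∘r f f-cong = begin
      ∑ (f ∘ p) xs
        ≈⟨ ∑-cong-∈ xs (λ {x} x∈ → sym (∑-delta T _≟ₜ_ f f-cong ys! (p∈ (toS x∈)))) ⟩
      ∑ (λ x → ∑ (λ y → [ p x ≟ₜ y ] f y) ys) xs
        ≈⟨ ∑-comm _ xs ys ⟩
      ∑ (λ y → ∑ (λ x → [ p x ≟ₜ y ] f y) xs) ys
        ≈⟨ ∑-cong-∈ ys (λ {y} y∈ → trans
             (∑-cong-∈ xs λ {x} x∈ → []-⇔ (p x ≟ₜ y) (r y ≟ₛ x)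
               (λ px≈y → transₛ (r-cong (symₜ px≈y)) (r∘p (toS x∈)))
               (λ ry≈x → transₜ (p-cong (symₛ ry≈x)) (p∘r (toT y∈))) (f y))
             (∑-delta S _≟ₛ_ (λ _ → f y) (λ _ → refl) xs! (r∈ (toT y∈)))) ⟩
      ∑ f ys ∎
      where
      toS : ∀ {x} → x ∈ᴸ xs → x ∈ₛ xs
      toS = Any.map (Setoid.reflexive S)
      toT : ∀ {y} → y ∈ᴸ ys → y ∈ₜ ys
      toT = Any.map (Setoid.reflexive T)

  -- Each x contributes to the summand of its own class `cl x` alone. Additively, the classes will
  -- be the H-orbits and the counts their lengths; multiplicatively, the classes will be the ring
  -- elements and the counts the exponents in the weight enumerator.
  sum-fibres : ∀ {k a p} {A : Set a} (cl : A → Fin k) {P : Fin k → Pred A p} →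
    (P? : ∀ i → Decidable (P i)) →
    (∀ i x → P i x → cl x ≡ i) → (∀ i x → cl x ≡ i → P i x) →
    (z : Fin k → Carrier) (xs : List A) →
    sum (λ i → length (filter (P? i) xs) ×ᴺ z i) ≈ ∑ (z ∘ cl) xs
  sum-fibres {k} cl P? P⇒ ⇒P z []       = sum-replicate-zero k
  sum-fibres {k} cl P? P⇒ ⇒P z (x ∷ xs) = begin
    sum (λ i → length (filter (P? i) (x ∷ xs)) ×ᴺ z i)
      ≈⟨ sum-cong-≋ step ⟩
    sum (λ i → [ cl x ≟ᶠ i ] z i ∙ length (filter (P? i) xs) ×ᴺ z i)
      ≈⟨ ∑-distrib-+ (λ i → [ cl x ≟ᶠ i ] z i) _ ⟩
    sum (λ i → [ cl x ≟ᶠ i ] z i) ∙ sum (λ i → length (filter (P? i) xs) ×ᴺ z i)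
      ≈⟨ ∙-cong (sum-delta (cl x) z) (sum-fibres cl P? P⇒ ⇒P z xs) ⟩
    z (cl x) ∙ ∑ (z ∘ cl) xs ∎
    where
    step : ∀ i → length (filter (P? i) (x ∷ xs)) ×ᴺ z i ≈
      [ cl x ≟ᶠ i ] z i ∙ length (filter (P? i) xs) ×ᴺ z i
    step i with P? i x
    ... | yes Px = ∙-congʳ (sym ([]-yes (cl x ≟ᶠ i) (P⇒ i x Px) (z i)))
    ... | no ¬Px = trans (sym (identityˡ _))
                     (∙-congʳ (sym ([]-no (cl x ≟ᶠ i) (¬Px ∘ ⇒P i x) (z i))))

  sum-↑ : ∀ m {n} (f : Fin (m ℕ.+ n) → Carrier) →
    sum f ≈ sum (λ i → f (i ↑ˡ n)) ∙ sum (λ j → f (m ↑ʳ j))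
  sum-↑ zero    f = sym (identityˡ _)
  sum-↑ (suc m) f = trans (∙-congˡ (sum-↑ m (f ∘ suc))) (sym (assoc _ _ _))

  sum-combine : ∀ m n (f : Fin (m ℕ.* n) → Carrier) →
    sum f ≈ sum (λ (i : Fin m) → sum (λ (j : Fin n) → f (combine i j)))
  sum-combine zero    n f = refl
  sum-combine (suc m) n f = trans (sum-↑ n f) (∙-congˡ (sum-combine m n (λ k → f (n ↑ʳ k))))

module SemiringListSum {c ℓ} (S : Semiring c ℓ) where
  open Semiring S hiding (zero)
  open ListSum +-commutativeMonoid

  *-distribˡ-∑ : ∀ {a} {A : Set a} z (f : A → Carrier) xs → z * ∑ f xs ≈ ∑ (λ x → z * f x) xs
  *-distribˡ-∑ z f []       = zeroʳ z
  *-distribˡ-∑ z f (x ∷ xs) = trans (distribˡ z (f x) _) (+-congˡ (*-distribˡ-∑ z f xs))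

  *-distribʳ-∑ : ∀ {a} {A : Set a} z (f : A → Carrier) xs → ∑ f xs * z ≈ ∑ (λ x → f x * z) xs
  *-distribʳ-∑ z f []       = zeroˡ z
  *-distribʳ-∑ z f (x ∷ xs) = trans (distribʳ z (f x) _) (+-congˡ (*-distribʳ-∑ z f xs))

-- Expansion of a product of sums.

module Distribute {c ℓ} (P : CommutativeSemiring c ℓ) where
  open CommutativeSemiring P hiding (zero)
  open SetoidReasoning setoid
  open RawMonoidDefs +-rawMonoid using (sum)
  open RawMonoidDefs *-rawMonoid using () renaming (sum to product)
  open SemiringSum semiring using (*-distribˡ-sum; *-distribʳ-sum; sum-cong-≋)
  module × = SumProps *-commutativeMonoid

  -- The choices of one summand per factor are numbered by `finToFun`, the numbering that
  -- `vector-finite` uses, so the expansion is already a sum over the enumerated vectors of R^t.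
  product-sum : ∀ t {q} (F : Fin t → Fin q → Carrier) →
    product (λ i → sum (F i)) ≈ sum (λ (k : Fin (q ℕ.^ t)) → product λ i → F i (finToFun k i))
  product-sum zero        F = sym (+-identityʳ 1#)
  product-sum (suc t) {q} F = begin
    sum (F zero) * product (λ i → sum (F (suc i)))
      ≈⟨ *-congˡ (product-sum t (F ∘ suc)) ⟩
    sum (F zero) * sum (λ k → product λ i → F (suc i) (finToFun k i))
      ≈⟨ *-distribʳ-sum {q} _ (F zero) ⟩
    sum (λ b → F zero b * sum (λ k → product λ i → F (suc i) (finToFun k i)))
      ≈⟨ sum-cong-≋ {q} (λ b → trans
           (*-distribˡ-sum {q ℕ.^ t} (F zero b) _) (sum-cong-≋ {q ℕ.^ t} λ k → expand b k)) ⟩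
    sum (λ (b : Fin q) → sum (λ (k : Fin (q ℕ.^ t)) → product λ i → F i (finToFun (combine b k) i)))
      ≈⟨ ListSum.sum-combine +-commutativeMonoid q (q ℕ.^ t)
           (λ k → product λ i → F i (finToFun k i)) ⟨
    sum (λ k → product λ i → F i (finToFun k i)) ∎
    where
    expand : ∀ (b : Fin q) (k : Fin (q ℕ.^ t)) →
      F zero b * product (λ i → F (suc i) (finToFun k i)) ≈
      product (λ i → F i (finToFun (combine b k) i))
    expand b k = *-cong
      (reflexive (≡.cong (F zero ∘ proj₁) (≡.sym (remQuot-combine b k))))
      (×.sum-cong-≋ {t} λ i → reflexive
        (≡.cong (λ k → F (suc i) (finToFun (proj₂ k) i)) (≡.sym (remQuot-combine b k))))

-- Enumeration of decidable subsets.

module _ {c ℓ p} {S : Setoid c ℓ} (fin : Finite S) (A : Subset S p) where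
  open Setoid S
  open Finite fin
  open Subset A
  open SetoidMembership S using () renaming (_∈_ to _∈ₛ_)

  elements-unique : Unique S (elements fin A)
  elements-unique = Unique.filter⁺ S mem?
    (Unique.map⁺ (≡.setoid (Fin size)) S
      (λ {i} {j} eq → ≡.trans (≡.sym (to-from i)) (≡.trans (to-cong eq) (to-from j)))
      (allFin⁺ size))

  ∈-elements⁺ : ∀ {x} → mem x → x ∈ₛ elements fin A
  ∈-elements⁺ {x} x∈A = SetoidMembershipProps.∈-filter⁺ S mem? mem-resp
    (SetoidMembershipProps.∈-resp-≈ S (from-to x)
      (SetoidMembershipProps.∈-map⁺ (≡.setoid (Fin size)) S
      (λ { ≡.refl → refl }) (∈-allFin (to x)))) x∈A

  ∈-elements⁻ : ∀ {x} → x ∈ₛ elements fin A → mem x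
  ∈-elements⁻ x∈ = proj₂
    (SetoidMembershipProps.∈-filter⁻ S mem? mem-resp {xs = map from (allFin size)} x∈)

-- The commutative semiring of polynomials.

module PolynomialSemiring (q : ℕ) where
  open Polynomial q
  open ListSum ℂᴿ.+-commutativeMonoid
  open SemiringListSum ℂᴿ.semiring using (*-distribˡ-∑)
  open SetoidReasoning ℂᴿ.setoid
  open CommutativeSemigroupProps ℂᴿ.*-commutativeSemigroup using (x∙yz≈y∙xz)

  private
    _≟_ : (e m : Monomial) → Dec (e ≡ m)
    _≟_ = ≡-dec ℕ._≟_

    _⊕_ : Monomial → Monomial → Monomial
    _⊕_ = Vec.zipWith ℕ._+_

    𝟘 : Monomial
    𝟘 = Vec.replicate q 0

    support : Poly → List Monomial
    support = map proj₂

  -- The linear extension of φ; all φ together determine a polynomial up to ≈ₚ,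
  -- and products become iterated extensions.
  eval : (Monomial → ℂ) → Poly → ℂ
  eval φ = ∑ λ (z , e) → z *ᶜ φ e

  -- Collects the terms with equal monomials, since each exponent of f occurs exactly once in L. L
  -- may exceed the support, so that two polynomials can share one list.
  eval-coeff : ∀ φ f {L} → Unique≡ L → (∀ {e} → e ∈ᴸ support f → e ∈ᴸ L) →
    eval φ f ≈ᶜ ∑ (λ m → coeff f m *ᶜ φ m) L
  eval-coeff φ []            {L} L! ⊆L =
    ℂᴿ.sym (ℂᴿ.trans (∑-cong L λ m → ℂᴿ.zeroˡ (φ m)) (∑-ε L))
  eval-coeff φ ((z , e) ∷ f) {L} L! ⊆L = begin
    z *ᶜ φ e +ᶜ eval φ f
      ≈⟨ ℂᴿ.+-cong (ℂᴿ.sym (∑-delta (≡.setoid Monomial) _≟_ (λ m → z *ᶜ φ m)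
           (λ { ≡.refl → ℂᴿ.refl }) L! (⊆L (here ≡.refl)))) (eval-coeff φ f L! (⊆L ∘ there)) ⟩
    ∑ (λ m → [ e ≟ m ] (z *ᶜ φ m)) L +ᶜ ∑ (λ m → coeff f m *ᶜ φ m) L
      ≈⟨ ∑-∙ _ _ L ⟨
    ∑ (λ m → [ e ≟ m ] (z *ᶜ φ m) +ᶜ coeff f m *ᶜ φ m) L
      ≈⟨ ∑-cong L (λ m → ℂᴿ.trans (ℂᴿ.+-congʳ ([]-* m (e ≟ m)))
           (ℂᴿ.sym (ℂᴿ.distribʳ (φ m) _ (coeff f m)))) ⟩
    ∑ (λ m → coeff ((z , e) ∷ f) m *ᶜ φ m) L ∎
    where
    []-* : ∀ m (e≟m : Dec (e ≡ m)) → [ e≟m ] (z *ᶜ φ m) ≈ᶜ ([ e≟m ] z) *ᶜ φ m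
    []-* m (yes _) = ℂᴿ.refl
    []-* m (no _)  = ℂᴿ.sym (ℂᴿ.zeroˡ (φ m))

  eval-congʳ : ∀ φ {f g} → f ≈ₚ g → eval φ f ≈ᶜ eval φ g
  eval-congʳ φ {f} {g} f≈g = begin
    eval φ f                          ≈⟨ eval-coeff φ f L! (∈L ∘ ∈-++⁺ˡ) ⟩
    ∑ (λ m → coeff f m *ᶜ φ m) L      ≈⟨ ∑-cong L (λ m → ℂᴿ.*-congʳ (coeff-≈ f≈g m)) ⟩
    ∑ (λ m → coeff g m *ᶜ φ m) L      ≈⟨ eval-coeff φ g L! (∈L ∘ ∈-++⁺ʳ (support f)) ⟨
    eval φ g                          ∎
    where
    L = deduplicate _≟_ (support f ++ support g)
    L! : Unique≡ L
    L! = deduplicate-! _≟_ (support f ++ support g)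
    ∈L : ∀ {e} → e ∈ᴸ support f ++ support g → e ∈ᴸ L
    ∈L = ∈-deduplicate⁺ _≟_

  -- A coefficient is itself an extension `eval φ`, so agreement under every φ implies equality of
  -- polynomials.
  coeff-eval : ∀ f m → coeff f m ≈ᶜ eval (λ e → [ e ≟ m ] 1ᶜ) f
  coeff-eval []            m = ℂᴿ.refl
  coeff-eval ((z , e) ∷ f) m = ℂᴿ.+-cong (lemma (e ≟ m)) (coeff-eval f m)
    where
    lemma : (e≟m : Dec (e ≡ m)) → [ e≟m ] z ≈ᶜ z *ᶜ [ e≟m ] 1ᶜ
    lemma (yes _) = ℂᴿ.sym (ℂᴿ.*-identityʳ z)
    lemma (no _)  = ℂᴿ.sym (ℂᴿ.zeroʳ z)

  eval-≈⇒≈ₚ : ∀ {f g} → (∀ φ → eval φ f ≈ᶜ eval φ g) → f ≈ₚ g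
  eval-≈⇒≈ₚ {f} {g} eq = mk≈ₚ λ m →
    ℂᴿ.trans (coeff-eval f m) (ℂᴿ.trans (eq _) (ℂᴿ.sym (coeff-eval g m)))

  eval-congˡ : ∀ {φ ψ} → (∀ e → φ e ≈ᶜ ψ e) → ∀ f → eval φ f ≈ᶜ eval ψ f
  eval-congˡ φ≈ψ f = ∑-cong f λ (z , e) → ℂᴿ.*-congˡ (φ≈ψ e)

  eval-≗ : ∀ φ {s t : Monomial → Monomial} → (∀ e → s e ≡ t e) →
    ∀ f → eval (φ ∘ s) f ≈ᶜ eval (φ ∘ t) f
  eval-≗ φ s≗t = eval-congˡ λ e → ℂᴿ.reflexive (≡.cong φ (s≗t e))

  eval-+ : ∀ φ f g → eval φ (f +ₚ g) ≈ᶜ eval φ f +ᶜ eval φ g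
  eval-+ φ []            g = ℂᴿ.sym (ℂᴿ.+-identityˡ _)
  eval-+ φ ((z , e) ∷ f) g =
    ℂᴿ.trans (ℂᴿ.+-congˡ (eval-+ φ f g)) (ℂᴿ.sym (ℂᴿ.+-assoc _ _ _))

  eval-* : ∀ φ f g → eval φ (f *ₚ g) ≈ᶜ eval (λ e → eval (λ d → φ (e ⊕ d)) g) f
  eval-* φ []            g = ℂᴿ.refl
  eval-* φ ((z , e) ∷ f) g = begin
    eval φ (map term g +ₚ f *ₚ g)
      ≈⟨ eval-+ φ (map term g) (f *ₚ g) ⟩
    eval φ (map term g) +ᶜ eval φ (f *ₚ g)
      ≈⟨ ℂᴿ.+-cong (eval-term g) (eval-* φ f g) ⟩
    z *ᶜ eval (λ d → φ (e ⊕ d)) g +ᶜ eval (λ e → eval (λ d → φ (e ⊕ d)) g) f ∎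
    where
    term : ℂ × Monomial → ℂ × Monomial
    term (w , d) = z *ᶜ w , e ⊕ d
    eval-term : ∀ g → eval φ (map term g) ≈ᶜ z *ᶜ eval (λ d → φ (e ⊕ d)) g
    eval-term []            = ℂᴿ.sym (ℂᴿ.zeroʳ z)
    eval-term ((w , d) ∷ g) = ℂᴿ.trans (ℂᴿ.+-cong (ℂᴿ.*-assoc z w _) (eval-term g))
      (ℂᴿ.sym (ℂᴿ.distribˡ z _ _))

  eval-const : ∀ φ z → eval φ (const z) ≈ᶜ z *ᶜ φ 𝟘
  eval-const φ z = ℂᴿ.+-identityʳ _

  eval-comm : ∀ (φ : Monomial → Monomial → ℂ) f g →
    eval (λ e → eval (φ e) g) f ≈ᶜ eval (λ d → eval (λ e → φ e d) f) g
  eval-comm φ f g = begin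
    ∑ (λ (z , e) → z *ᶜ ∑ (λ (w , d) → w *ᶜ φ e d) g) f
      ≈⟨ ∑-cong f (λ (z , e) → *-distribˡ-∑ z _ g) ⟩
    ∑ (λ (z , e) → ∑ (λ (w , d) → z *ᶜ (w *ᶜ φ e d)) g) f
      ≈⟨ ∑-comm _ f g ⟩
    ∑ (λ (w , d) → ∑ (λ (z , e) → z *ᶜ (w *ᶜ φ e d)) f) g
      ≈⟨ ∑-cong g (λ (w , d) → ∑-cong f λ (z , e) → x∙yz≈y∙xz z w _) ⟩
    ∑ (λ (w , d) → ∑ (λ (z , e) → w *ᶜ (z *ᶜ φ e d)) f) g
      ≈⟨ ∑-cong g (λ (w , d) → *-distribˡ-∑ w _ f) ⟨
    ∑ (λ (w , d) → w *ᶜ ∑ (λ (z , e) → z *ᶜ φ e d) f) g ∎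

  ≈ₚ-refl : ∀ {f} → f ≈ₚ f
  ≈ₚ-refl = mk≈ₚ λ _ → ℂᴿ.refl

  ≈ₚ-sym : ∀ {f g} → f ≈ₚ g → g ≈ₚ f
  ≈ₚ-sym (mk≈ₚ eq) = mk≈ₚ λ m → ℂᴿ.sym (eq m)

  ≈ₚ-trans : ∀ {f g h} → f ≈ₚ g → g ≈ₚ h → f ≈ₚ h
  ≈ₚ-trans (mk≈ₚ eq) (mk≈ₚ eq′) = mk≈ₚ λ m → ℂᴿ.trans (eq m) (eq′ m)

  +ₚ-cong : ∀ {f f′ g g′} → f ≈ₚ f′ → g ≈ₚ g′ → f +ₚ g ≈ₚ f′ +ₚ g′
  +ₚ-cong {f} {f′} {g} {g′} f≈ g≈ = eval-≈⇒≈ₚ λ φ → begin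
    eval φ (f +ₚ g)            ≈⟨ eval-+ φ f g ⟩
    eval φ f +ᶜ eval φ g       ≈⟨ ℂᴿ.+-cong (eval-congʳ φ f≈) (eval-congʳ φ g≈) ⟩
    eval φ f′ +ᶜ eval φ g′     ≈⟨ eval-+ φ f′ g′ ⟨
    eval φ (f′ +ₚ g′)          ∎

  +ₚ-assoc : ∀ f g h → (f +ₚ g) +ₚ h ≈ₚ f +ₚ (g +ₚ h)
  +ₚ-assoc []      g h = ≈ₚ-refl
  -- `x ∷ f` is `(x ∷ []) +ₚ f` by computation, so the head splits off as a summand.
  +ₚ-assoc (x ∷ f) g h = +ₚ-cong {x ∷ []} ≈ₚ-refl (+ₚ-assoc f g h)

  +ₚ-comm : ∀ f g → f +ₚ g ≈ₚ g +ₚ f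
  +ₚ-comm f g = eval-≈⇒≈ₚ λ φ → begin
    eval φ (f +ₚ g)            ≈⟨ eval-+ φ f g ⟩
    eval φ f +ᶜ eval φ g       ≈⟨ ℂᴿ.+-comm _ _ ⟩
    eval φ g +ᶜ eval φ f       ≈⟨ eval-+ φ g f ⟨
    eval φ (g +ₚ f)            ∎

  +ₚ-identityʳ : ∀ f → f +ₚ [] ≈ₚ f
  +ₚ-identityʳ f = +ₚ-comm f []

  *ₚ-cong : ∀ {f f′ g g′} → f ≈ₚ f′ → g ≈ₚ g′ → f *ₚ g ≈ₚ f′ *ₚ g′
  *ₚ-cong {f} {f′} {g} {g′} f≈ g≈ = eval-≈⇒≈ₚ λ φ → begin
    eval φ (f *ₚ g)                               ≈⟨ eval-* φ f g ⟩
    eval (λ e → eval (λ d → φ (e ⊕ d)) g) f       ≈⟨ eval-congʳ _ f≈ ⟩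
    eval (λ e → eval (λ d → φ (e ⊕ d)) g) f′      ≈⟨ eval-congˡ (λ e → eval-congʳ _ g≈) f′ ⟩
    eval (λ e → eval (λ d → φ (e ⊕ d)) g′) f′     ≈⟨ eval-* φ f′ g′ ⟨
    eval φ (f′ *ₚ g′)                             ∎

  *ₚ-assoc : ∀ f g h → (f *ₚ g) *ₚ h ≈ₚ f *ₚ (g *ₚ h)
  *ₚ-assoc f g h = eval-≈⇒≈ₚ λ φ → begin
    eval φ ((f *ₚ g) *ₚ h)
      ≈⟨ eval-* φ (f *ₚ g) h ⟩
    eval (λ e → eval (λ c → φ (e ⊕ c)) h) (f *ₚ g)
      ≈⟨ eval-* _ f g ⟩
    eval (λ e → eval (λ d → eval (λ c → φ ((e ⊕ d) ⊕ c)) h) g) f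
      ≈⟨ eval-congˡ (λ e → eval-congˡ (λ d →
           eval-≗ φ (λ c → zipWith-assoc ℕ.+-assoc e d c) h) g) f ⟩
    eval (λ e → eval (λ d → eval (λ c → φ (e ⊕ (d ⊕ c))) h) g) f
      ≈⟨ eval-congˡ (λ e → eval-* _ g h) f ⟨
    eval (λ e → eval (λ d → φ (e ⊕ d)) (g *ₚ h)) f
      ≈⟨ eval-* φ f (g *ₚ h) ⟨
    eval φ (f *ₚ (g *ₚ h)) ∎

  *ₚ-comm : ∀ f g → f *ₚ g ≈ₚ g *ₚ f
  *ₚ-comm f g = eval-≈⇒≈ₚ λ φ → begin
    eval φ (f *ₚ g)                               ≈⟨ eval-* φ f g ⟩
    eval (λ e → eval (λ d → φ (e ⊕ d)) g) f       ≈⟨ eval-comm _ f g ⟩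
    eval (λ d → eval (λ e → φ (e ⊕ d)) f) g
      ≈⟨ eval-congˡ (λ d → eval-≗ φ (λ e → zipWith-comm ℕ.+-comm e d) f) g ⟩
    eval (λ d → eval (λ e → φ (d ⊕ e)) f) g       ≈⟨ eval-* φ g f ⟨
    eval φ (g *ₚ f)                               ∎

  *ₚ-identityˡ : ∀ f → const 1ᶜ *ₚ f ≈ₚ f
  *ₚ-identityˡ f = eval-≈⇒≈ₚ λ φ → begin
    eval φ (const 1ᶜ *ₚ f)               ≈⟨ eval-* φ (const 1ᶜ) f ⟩
    eval (λ e → eval (λ d → φ (e ⊕ d)) f) (const 1ᶜ)
      ≈⟨ eval-const (λ e → eval (λ d → φ (e ⊕ d)) f) 1ᶜ ⟩
    1ᶜ *ᶜ eval (λ d → φ (𝟘 ⊕ d)) f       ≈⟨ ℂᴿ.*-identityˡ _ ⟩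
    eval (λ d → φ (𝟘 ⊕ d)) f             ≈⟨ eval-≗ φ (zipWith-identityˡ ℕ.+-identityˡ) f ⟩
    eval φ f                             ∎

  *ₚ-distribʳ : ∀ f g h → (g +ₚ h) *ₚ f ≈ₚ g *ₚ f +ₚ h *ₚ f
  *ₚ-distribʳ f g h = eval-≈⇒≈ₚ λ φ → begin
    eval φ ((g +ₚ h) *ₚ f)                 ≈⟨ eval-* φ (g +ₚ h) f ⟩
    eval _ (g +ₚ h)                        ≈⟨ eval-+ _ g h ⟩
    eval _ g +ᶜ eval _ h                   ≈⟨ ℂᴿ.+-cong (eval-* φ g f) (eval-* φ h f) ⟨
    eval φ (g *ₚ f) +ᶜ eval φ (h *ₚ f)     ≈⟨ eval-+ φ (g *ₚ f) (h *ₚ f) ⟨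
    eval φ (g *ₚ f +ₚ h *ₚ f)              ∎

  commutativeSemiring : CommutativeSemiring 0ℓ 0ℓ
  commutativeSemiring = record
    { Carrier = Poly
    ; _≈_ = _≈ₚ_
    ; _+_ = _+ₚ_
    ; _*_ = _*ₚ_
    ; 0#  = []
    ; 1#  = const 1ᶜ
    ; isCommutativeSemiring = record
      { isSemiring = record
        { isSemiringWithoutAnnihilatingZero = record
          { +-isCommutativeMonoid = record
            { isMonoid = record
              { isSemigroup = record
                { isMagma = record
                  { isEquivalence = record
                    { refl = ≈ₚ-refl ; sym = ≈ₚ-sym ; trans = ≈ₚ-trans }
                  ; ∙-cong = +ₚ-cong
                  }
                ; assoc = +ₚ-assoc
                }
              ; identity = (λ _ → ≈ₚ-refl) , +ₚ-identityʳ
              }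
            ; comm = +ₚ-comm
            }
          ; *-cong     = *ₚ-cong
          ; *-assoc    = *ₚ-assoc
          ; *-identity = *ₚ-identityˡ , λ f → ≈ₚ-trans (*ₚ-comm f (const 1ᶜ)) (*ₚ-identityˡ f)
          ; distrib    = (λ f g h → ≈ₚ-trans (*ₚ-comm f (g +ₚ h)) (≈ₚ-trans (*ₚ-distribʳ f g h)
                           (+ₚ-cong (*ₚ-comm g f) (*ₚ-comm h f))))
                       , *ₚ-distribʳ
          }
        ; zero = (λ _ → ≈ₚ-refl) , (λ f → *ₚ-comm f [])
        }
      ; *-comm = *ₚ-comm
      }
    }

  const-cong : ∀ {z w} → z ≈ᶜ w → const z ≈ₚ const w
  const-cong {z} {w} z≈w = eval-≈⇒≈ₚ λ φ → ℂᴿ.+-congʳ (ℂᴿ.*-congʳ z≈w)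

  const-0 : const 0ᶜ ≈ₚ []
  const-0 = eval-≈⇒≈ₚ λ φ → ℂᴿ.trans (eval-const φ 0ᶜ) (ℂᴿ.zeroˡ _)

  const-+ : ∀ z w → const (z +ᶜ w) ≈ₚ const z +ₚ const w
  const-+ z w = eval-≈⇒≈ₚ λ φ → ℂᴿ.trans (ℂᴿ.+-congʳ (ℂᴿ.distribʳ _ z w)) (ℂᴿ.+-assoc _ _ _)

  const-* : ∀ z w → const (z *ᶜ w) ≈ₚ const z *ₚ const w
  const-* z w = ≈ₚ-sym (eval-≈⇒≈ₚ λ φ → begin
    eval φ (const z *ₚ const w)        ≈⟨ eval-* φ (const z) (const w) ⟩
    eval (λ e → eval (λ d → φ (e ⊕ d)) (const w)) (const z)
      ≈⟨ eval-const (λ e → eval (λ d → φ (e ⊕ d)) (const w)) z ⟩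
    z *ᶜ eval (λ d → φ (𝟘 ⊕ d)) (const w)
      ≈⟨ ℂᴿ.*-congˡ (eval-const (λ d → φ (𝟘 ⊕ d)) w) ⟩
    z *ᶜ (w *ᶜ φ (𝟘 ⊕ 𝟘))
      ≈⟨ ℂᴿ.*-congˡ (ℂᴿ.*-congˡ (ℂᴿ.reflexive (≡.cong φ (zipWith-identityˡ ℕ.+-identityˡ 𝟘)))) ⟩
    z *ᶜ (w *ᶜ φ 𝟘)                    ≈⟨ ℂᴿ.*-assoc z w _ ⟨
    z *ᶜ w *ᶜ φ 𝟘                      ≈⟨ eval-const φ _ ⟨
    eval φ (const (z *ᶜ w))            ∎)

-- Character sums and nondegeneracy of generating characters.

module CharacterSums where
  open RawMonoidDefs ℂᴿ.+-rawMonoid using () renaming (_×_ to _×ᶜ_)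
  open ListSum ℂᴿ.+-commutativeMonoid

  -- z fixes s, so (z - 1) s = 0.
  apart-fixed⇒≈1 : ∀ {z s} → Apart s → z *ᶜ s ≈ᶜ s → z ≈ᶜ 1ᶜ
  apart-fixed⇒≈1 {z} {s} apart zs≈s = x∙y⁻¹≈ε⇒x≈y z 1ᶜ (apart-cancel apart (begin
    s *ᶜ (z ℂᴿ.- 1ᶜ)            ≈⟨ ℂᴿ.distribˡ s z _ ⟩
    s *ᶜ z +ᶜ s *ᶜ (-ᶜ 1ᶜ)      ≈⟨ ℂᴿ.+-cong (ℂᴿ.*-comm s z) (ℂᴿ.sym (-‿distribʳ-* s 1ᶜ)) ⟩
    z *ᶜ s ℂᴿ.- (s *ᶜ 1ᶜ)       ≈⟨ ℂᴿ.+-cong zs≈s (ℂᴿ.-‿cong (ℂᴿ.*-identityʳ s)) ⟩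
    s ℂᴿ.- s                    ≈⟨ ℂᴿ.-‿inverseʳ s ⟩
    0ᶜ                          ∎))
    where
    open SetoidReasoning ℂᴿ.setoid
    open RingProps ℂᴿ.ring using (-‿distribʳ-*)
    open GroupProps ℂᴿ.+-group using (x∙y⁻¹≈ε⇒x≈y)

  module _ (G : Group c ℓ) (fin : Finite (Group.setoid G)) (A : Subset (Group.setoid G) p)
    (∙-closed : ∀ {x y} → x ∈ A → y ∈ A → Group._∙_ G x y ∈ A)
    (⁻¹-closed : ∀ {x} → x ∈ A → Group._⁻¹ G x ∈ A)
    where
    open Group G
    open GroupProps G using (\\-leftDividesˡ; \\-leftDividesʳ)

    module _ (ψ : Carrier → ℂ) (ψ-cong : ∀ {x y} → x ≈ y → ψ x ≈ᶜ ψ y)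
             (ψ-homo : ∀ x y → ψ (x ∙ y) ≈ᶜ ψ x *ᶜ ψ y) where

      -- Translation by x permutes A, with translation by the inverse of x undoing it.
      character-sum-fixed : ∀ {x} → x ∈ A → ψ x *ᶜ ∑ ψ (elements fin A) ≈ᶜ ∑ ψ (elements fin A)
      character-sum-fixed {x} x∈A = begin
        ψ x *ᶜ ∑ ψ (elements fin A)
          ≈⟨ SemiringListSum.*-distribˡ-∑ ℂᴿ.semiring (ψ x) ψ (elements fin A) ⟩
        ∑ (λ y → ψ x *ᶜ ψ y) (elements fin A)
          ≈⟨ ∑-cong (elements fin A) (λ y → ψ-homo x y) ⟨
        ∑ (λ y → ψ (x ∙ y)) (elements fin A)
          ≈⟨ ∑-reindex setoid setoid _≟_ _≟_ A! A! (x ∙_) (x ⁻¹ ∙_) ∙-congˡ ∙-congˡ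
               (λ y∈ → ∈-elements⁺ fin A (∙-closed x∈A (∈-elements⁻ fin A y∈)))
               (λ y∈ → ∈-elements⁺ fin A (∙-closed (⁻¹-closed x∈A) (∈-elements⁻ fin A y∈)))
               (λ _ → \\-leftDividesʳ x _) (λ _ → \\-leftDividesˡ x _) ψ ψ-cong ⟩
        ∑ ψ (elements fin A) ∎
        where
        open SetoidReasoning ℂᴿ.setoid
        open Finite fin using (_≟_)
        A! = elements-unique fin A

      apart-character-sum : Apart (∑ ψ (elements fin A)) → ∀ {x} → x ∈ A → ψ x ≈ᶜ 1ᶜ
      apart-character-sum apart x∈A = apart-fixed⇒≈1 apart (character-sum-fixed x∈A)

  -- Doubly negated because ℂ has no decidable equality.
  IsNat : ℂ → Set
  IsNat z = ¬ ¬ ∃ λ n → z ≈ᶜ n ×ᶜ 1ᶜ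

  -- Double negation commutes with finite conjunctions, so all summands may be taken to be natural
  -- numbers at once.
  isNat-∑ : ∀ {a} {A : Set a} {f : A → ℂ} → (∀ x → IsNat (f x)) → ∀ xs → IsNat (∑ f xs)
  isNat-∑ f-nat []       ¬nat = ¬nat (0 , ℂᴿ.refl)
  isNat-∑ f-nat (x ∷ xs) ¬nat = f-nat x λ (m , fx≈m) → isNat-∑ f-nat xs λ (n , ∑≈n) →
    ¬nat (m ℕ.+ n , ℂᴿ.trans (ℂᴿ.+-cong fx≈m ∑≈n) (ℂᴿ.sym (MultProps.×-homo-+ ℂᴿ.+-monoid 1ᶜ m n)))

  module CharacterValues (R : Ring c ℓ) (χ : Character R) where
    open Ring R
    open Character χ

    φ : Carrier → ℂ
    φ x = value ⟦ x ⟧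

    φ-cong : ∀ {x y} → x ≈ y → φ x ≈ᶜ φ y
    φ-cong x≈y = _≈ˣ_.value-≈ (⟦⟧-cong x≈y)

    φ-+ : ∀ x y → φ (x + y) ≈ᶜ φ x *ᶜ φ y
    φ-+ x y = _≈ˣ_.value-≈ (homo x y)

    φ-0 : ∀ {x} → x ≈ 0# → φ x ≈ᶜ 1ᶜ
    φ-0 x≈0 = ℂᴿ.trans (φ-cong x≈0) (_≈ˣ_.value-≈ (IsGroupHomomorphism.ε-homo isHomo))
  
    -- The kernel of χ contains no nonzero principal right ideal a R, respectively no nonzero
    -- principal left ideal R a.
    RightNondegenerate LeftNondegenerate : Set _
    RightNondegenerate = ∀ a → (∀ x → φ (a * x) ≈ᶜ 1ᶜ) → a ≈ 0#
    LeftNondegenerate  = ∀ a → (∀ x → φ (x * a) ≈ᶜ 1ᶜ) → a ≈ 0#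

    -- If χ is trivial on a R, then χ^a and χ^0 are the same character, and r ↦ χ^r is injective.
    rightGenerating⇒rightNondegenerate : IsRightGenerating R χ → RightNondegenerate
    rightGenerating⇒rightNondegenerate gen a φ≈1 = IsRightModuleIsomorphism.injective gen
      λ x → mk≈ˣ (ℂᴿ.trans (φ≈1 x) (ℂᴿ.sym (φ-0 (zeroˡ x))))

    leftGenerating⇒leftNondegenerate : IsLeftGenerating R χ → LeftNondegenerate
    leftGenerating⇒leftNondegenerate gen a φ≈1 = IsLeftModuleIsomorphism.injective gen
      λ x → mk≈ˣ (ℂᴿ.trans (φ≈1 x) (ℂᴿ.sym (φ-0 (zeroʳ x))))

    module _ (finite : Finite setoid) where
      open Finite finite using (_≟_)

      private
        whole : Subset setoid 0ℓ
        whole = record { mem = λ _ → ⊤ ; mem? = λ _ → yes tt ; mem-resp = λ _ _ → tt }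

        xs : List Carrier
        xs = elements finite whole

        ∣R∣ : ℕ
        ∣R∣ = ∣_∣ finite whole

        ∣R∣≢0 : ℕ.NonZero ∣R∣
        ∣R∣≢0 = ∣_∣-nonZero finite whole (0# , tt)

        apart-∑φ : ∀ (s : Carrier → Carrier) → (∀ {x y} → x ≈ y → s x ≈ s y) →
          (∀ x y → s (x + y) ≈ s x + s y) →
          Apart (∑ (λ x → φ (s x)) xs) → ∀ x → φ (s x) ≈ᶜ 1ᶜ
        apart-∑φ s s-cong s-homo apart x = apart-character-sum +-group finite whole
          (λ _ _ → tt) (λ _ → tt) (λ x → φ (s x)) (λ x≈y → φ-cong (s-cong x≈y))
          (λ x y → ℂᴿ.trans (φ-cong (s-homo x y)) (φ-+ (s x) (s y))) apart {x} tt

        ∑≈1 : ∀ {f : Carrier → ℂ} → (∀ x → f x ≈ᶜ 1ᶜ) → ∑ f xs ≈ᶜ ∣R∣ ×ᶜ 1ᶜ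
        ∑≈1 f≈1 = ℂᴿ.trans (∑-cong xs f≈1) (∑-const 1ᶜ xs)

      -- Let T y = Σ_r χ (r y). Each T y is 0 or ∣R∣, and Σ_y T y = ∣R∣ by right
      -- nondegeneracy. As T 0 = ∣R∣, no other T y can be ∣R∣.
      rightNondegenerate⇒leftNondegenerate : RightNondegenerate → LeftNondegenerate
      rightNondegenerate⇒leftNondegenerate nondeg a φ≈1 with a ≟ 0#
      ... | yes a≈0 = a≈0
      -- The goal is now absurdity, so the doubly negated n may be used. The two evaluations of Σ_y
      -- T y give ∣R∣ = ∣R∣ + (∣R∣ + n), where 0 and a contribute ∣R∣ each; hence ∣R∣ = 0.
      ... | no  a≉0 = ⊥-elim (isNat-∑ rest-nat xs λ (n , ∑rest≈n) →
        ℕ.≢-nonZero⁻¹ ∣R∣ {{∣R∣≢0}} (ℕ.m+n≡0⇒m≡0 ∣R∣ (ℕ.+-cancelˡ-≡ ∣R∣ _ _ (≡.trans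
          (≡.sym (×1ᶜ-injective (ℂᴿ.trans (ℂᴿ.sym ∑T≈∣R∣) (∑T≈ n ∑rest≈n))))
          (≡.sym (ℕ.+-identityʳ ∣R∣))))))
        where
        open SetoidReasoning ℂᴿ.setoid

        T : Carrier → ℂ
        T y = ∑ (λ r → φ (r * y)) xs

        T-cong : ∀ {y z} → y ≈ z → T y ≈ᶜ T z
        T-cong y≈z = ∑-cong xs λ r → φ-cong (*-congˡ y≈z)

        T-nat : ∀ y → IsNat (T y)
        -- The hypothesis is used twice. Were T y apart from 0, all its summands would be 1 and T y
        -- would be ∣R∣, which `¬nat` refutes; so T y is 0, which `¬nat` refutes as well.
        T-nat y ¬nat = ¬nat (0 , ¬apart⇒≈0 λ apart →
          ¬nat (∣R∣ , ∑≈1 (apart-∑φ (_* y) *-congʳ (distribʳ y) apart)))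

        -- For nonzero r, a sum apart from 0 would make χ trivial on r R, against right
        -- nondegeneracy.
        row : ∀ r → (0≟r : Dec (0# ≈ r)) → ∑ (λ y → φ (r * y)) xs ≈ᶜ [ 0≟r ] (∣R∣ ×ᶜ 1ᶜ)
        row r (yes 0≈r) = ∑≈1 λ y → φ-0 (trans (*-congʳ (sym 0≈r)) (zeroˡ y))
        row r (no  0≉r) = ¬apart⇒≈0 λ apart →
          0≉r (sym (nondeg r (apart-∑φ (r *_) *-congˡ (distribˡ r) apart)))

        delta : ∀ x (f : Carrier → ℂ) → (∀ {y} → x ≈ y → f x ≈ᶜ f y) →
          ∑ (λ y → [ x ≟ y ] f y) xs ≈ᶜ f x
        delta x f f-cong = ∑-delta setoid _≟_ f f-cong (elements-unique finite whole)
          (∈-elements⁺ finite whole tt)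

        ∑T≈∣R∣ : ∑ T xs ≈ᶜ ∣R∣ ×ᶜ 1ᶜ
        ∑T≈∣R∣ = begin
          ∑ T xs                                      ≈⟨ ∑-comm (λ y r → φ (r * y)) xs xs ⟩
          ∑ (λ r → ∑ (λ y → φ (r * y)) xs) xs         ≈⟨ ∑-cong xs (λ r → row r (0# ≟ r)) ⟩
          ∑ (λ r → [ 0# ≟ r ] (∣R∣ ×ᶜ 1ᶜ)) xs
          ≈⟨ delta 0# (λ _ → ∣R∣ ×ᶜ 1ᶜ) (λ _ → ℂᴿ.refl) ⟩
          ∣R∣ ×ᶜ 1ᶜ                                   ∎

        -- What remains of T once its values at 0 and at a are split off; since a ≠ 0 these are two
        -- different places.
        rest : Carrier → ℂ
        rest y = [ ¬? (0# ≟ y) ] ([ ¬? (a ≟ y) ] T y)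

        []-nat : ∀ {p} {P : Set p} (P? : Dec P) {z} → IsNat z → IsNat ([ P? ] z)
        []-nat (yes _) z-nat = z-nat
        []-nat (no _)  _     = λ ¬nat → ¬nat (0 , ℂᴿ.refl)

        rest-nat : ∀ y → IsNat (rest y)
        rest-nat y = []-nat (¬? (0# ≟ y)) ([]-nat (¬? (a ≟ y)) (T-nat y))

        split : ∀ {y} (0≟y : Dec (0# ≈ y)) (a≟y : Dec (a ≈ y)) z →
          z ≈ᶜ [ 0≟y ] z +ᶜ ([ a≟y ] z +ᶜ [ ¬? 0≟y ] ([ ¬? a≟y ] z))
        split (no _)    (no _)    z = ℂᴿ.sym (ℂᴿ.trans (ℂᴿ.+-identityˡ _) (ℂᴿ.+-identityˡ _))
        split (no _)    (yes _)   z = ℂᴿ.sym (ℂᴿ.trans (ℂᴿ.+-identityˡ _) (ℂᴿ.+-identityʳ _))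
        split (yes _)   (no _)    z =
          ℂᴿ.sym (ℂᴿ.trans (ℂᴿ.+-congˡ (ℂᴿ.+-identityˡ 0ᶜ)) (ℂᴿ.+-identityʳ _))
        split (yes 0≈y) (yes a≈y) z = contradiction (trans a≈y (sym 0≈y)) a≉0

        ∑T≈ : ∀ n → ∑ rest xs ≈ᶜ n ×ᶜ 1ᶜ → ∑ T xs ≈ᶜ (∣R∣ ℕ.+ (∣R∣ ℕ.+ n)) ×ᶜ 1ᶜ
        ∑T≈ n ∑rest≈n = begin
          ∑ T xs
            ≈⟨ ∑-cong xs (λ y → split (0# ≟ y) (a ≟ y) (T y)) ⟩
          ∑ (λ y → [ 0# ≟ y ] T y +ᶜ ([ a ≟ y ] T y +ᶜ rest y)) xs
            ≈⟨ ℂᴿ.trans (∑-∙ _ _ xs) (ℂᴿ.+-congˡ (∑-∙ _ rest xs)) ⟩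
          ∑ (λ y → [ 0# ≟ y ] T y) xs +ᶜ (∑ (λ y → [ a ≟ y ] T y) xs +ᶜ ∑ rest xs)
            ≈⟨ ℂᴿ.+-cong (delta 0# T T-cong) (ℂᴿ.+-cong (delta a T T-cong) ∑rest≈n) ⟩
          T 0# +ᶜ (T a +ᶜ n ×ᶜ 1ᶜ)
            ≈⟨ ℂᴿ.+-cong (∑≈1 λ r → φ-0 (zeroʳ r)) (ℂᴿ.+-congʳ (∑≈1 φ≈1)) ⟩
          ∣R∣ ×ᶜ 1ᶜ +ᶜ (∣R∣ ×ᶜ 1ᶜ +ᶜ n ×ᶜ 1ᶜ)
            ≈⟨ ℂᴿ.trans (MultProps.×-homo-+ ℂᴿ.+-monoid 1ᶜ ∣R∣ _)
               (ℂᴿ.+-congˡ (MultProps.×-homo-+ ℂᴿ.+-monoid 1ᶜ ∣R∣ n)) ⟨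
          (∣R∣ ℕ.+ (∣R∣ ℕ.+ n)) ×ᶜ 1ᶜ ∎

      generating⇒leftNondegenerate : IsGenerating R χ → LeftNondegenerate
      generating⇒leftNondegenerate (inj₁ right) =
        rightNondegenerate⇒leftNondegenerate (rightGenerating⇒rightNondegenerate right)
      generating⇒leftNondegenerate (inj₂ left)  = leftGenerating⇒leftNondegenerate left

open CharacterSums

-- Permutations and orbits.

_≟ₚₑᵣₘ_ : (g h : Permutation′ n) → Dec (g ≈ₚₑᵣₘ h)
g ≟ₚₑᵣₘ h = all? λ i → (g ⟨$⟩ʳ i) ≟ᶠ (h ⟨$⟩ʳ i)

-- Equality of permutations compares the forward maps only, but the action on V uses the inverses.
⟨$⟩ˡ-cong : ∀ {g h : Permutation′ n} → g ≈ₚₑᵣₘ h → ∀ i → g ⟨$⟩ˡ i ≡ h ⟨$⟩ˡ i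
⟨$⟩ˡ-cong {g = g} {h} g≈h i = ≡.trans (≡.sym (inverseˡ h {_}))
  (≡.cong (h ⟨$⟩ˡ_) (≡.trans (≡.sym (g≈h (g ⟨$⟩ˡ i))) (inverseʳ g)))

module _ (H : PermGroup n) where
  open PermGroup H

  ∈ᴸ⇒∈ᴳ : ∀ {h} → h ∈ᴸ perms → h ∈ᴳ H
  ∈ᴸ⇒∈ᴳ = Any.map λ { ≡.refl _ → ≡.refl }

  ∈ᴳ⇒∈Orbit : ∀ {h} → h ∈ᴳ H → ∀ i → _∈Orbit_ H (h ⟨$⟩ʳ i) i
  ∈ᴳ⇒∈Orbit h∈H i = Any.map (λ h≈k → ≡.sym (h≈k i)) h∈H

  module OrbitMap (O : Orbits H) where
    open Orbits O

    orbit : Fin n → Fin t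
    orbit j = proj₁ (cover j)

    -- If g carries the representative to j, then `g ∘ₚ h` carries it to the image of j, and
    -- `disjoint` leaves only one index.
    orbit-⟨$⟩ʳ : ∀ {h} → h ∈ᴳ H → ∀ j → orbit (h ⟨$⟩ʳ j) ≡ orbit j
    orbit-⟨$⟩ʳ {h} h∈H j with find (proj₂ (cover j))
    ... | g , g∈H , gα≡j = disjoint (proj₂ (cover (h ⟨$⟩ʳ j)))
      (≡.subst (λ k → _∈Orbit_ H (h ⟨$⟩ʳ k) (α (orbit j))) gα≡j
        (∈ᴳ⇒∈Orbit {g ∘ₚ h} (∘-closed {g} {h} (∈ᴸ⇒∈ᴳ g∈H) h∈H) (α (orbit j))))

    orbit-α : ∀ i → orbit (α i) ≡ i
    orbit-α i = disjoint (proj₂ (cover (α i))) (∈ᴳ⇒∈Orbit {idₚ} id-mem (α i))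

-- The averaging map θ and orbit coordinates.

module Averaging (R : Ring c ℓ) (finite : Finite (Ring.setoid R)) (n : ℕ)
                 (H : PermGroup n) (inv : Code.OrderInvertible R finite n H) where
  open Ring R hiding (zero)
  open Code R finite n
  open PermGroup H
  open ListSum +-commutativeMonoid
  open SemiringListSum semiring
  open RawMonoidDefs +-rawMonoid using (sum) renaming (_×_ to _×ᴺ_)
  open SumProps +-commutativeMonoid using (sum-cong-≋; sum-permute)
  open SemiringMult semiring using (×-assoc-*; ×-comm-*; ×-congʳ)
  open SetoidReasoning setoid

  ν : Carrier
  ν = proj₁ inv

  θᴴ : V → V
  θᴴ = θ H inv

  central-× : ∀ k x → x * (k ×ᴺ 1#) ≈ (k ×ᴺ 1#) * x
  central-× k x = begin
    x * (k ×ᴺ 1#)    ≈⟨ ×-comm-* k x 1# ⟩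
    k ×ᴺ (x * 1#)    ≈⟨ ×-congʳ k (trans (*-identityʳ x) (sym (*-identityˡ x))) ⟩
    k ×ᴺ (1# * x)    ≈⟨ ×-assoc-* k 1# x ⟨
    (k ×ᴺ 1#) * x    ∎

  -- The inverse of a central unit is central. R need not be commutative, and in `⟨,θ⟩` the factor ν
  -- has to pass an entry on its left.
  ν-central : ∀ x → x * ν ≈ ν * x
  ν-central x = begin
    x * ν                      ≈⟨ *-identityˡ _ ⟨
    1# * (x * ν)               ≈⟨ *-congʳ (proj₁ (proj₂ inv)) ⟨
    (ν * N) * (x * ν)          ≈⟨ *-assoc ν N _ ⟩
    ν * (N * (x * ν))          ≈⟨ *-congˡ (*-assoc N x ν) ⟨
    ν * (N * x * ν)            ≈⟨ *-congˡ (*-congʳ (central-× order x)) ⟨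
    ν * (x * N * ν)            ≈⟨ *-congˡ (*-assoc x N ν) ⟩
    ν * (x * (N * ν))          ≈⟨ *-congˡ (*-congˡ (proj₂ (proj₂ inv))) ⟩
    ν * (x * 1#)               ≈⟨ *-congˡ (*-identityʳ x) ⟩
    ν * x                      ∎
    where N = order ×ᴺ 1#

  ν*order× : ∀ x → ν * (order ×ᴺ x) ≈ x
  ν*order× x = begin
    ν * (order ×ᴺ x)           ≈⟨ *-congˡ (×-congʳ order (*-identityˡ x)) ⟨
    ν * (order ×ᴺ (1# * x))    ≈⟨ *-congˡ (×-assoc-* order 1# x) ⟨
    ν * (order ×ᴺ 1# * x)      ≈⟨ *-assoc ν _ x ⟨
    ν * (order ×ᴺ 1#) * x      ≈⟨ *-congʳ (proj₁ (proj₂ inv)) ⟩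
    1# * x                     ≈⟨ *-identityˡ x ⟩
    x                          ∎

  Invariant : V → Set _
  Invariant v = ∀ h → h ∈ᴳ H → ∀ i → v (h ⟨$⟩ʳ i) ≈ v i

  invariant-resp : ∀ {u v} → u ≋ v → Invariant u → Invariant v
  invariant-resp u≋v inv-u h h∈H i = trans (sym (u≋v _)) (trans (inv-u h h∈H i) (u≋v i))

  invariant-⟨$⟩ˡ : ∀ {v} → Invariant v → ∀ h → h ∈ᴳ H → ∀ i → v (h ⟨$⟩ˡ i) ≈ v i
  invariant-⟨$⟩ˡ {v} inv-v h h∈H i =
    trans (sym (inv-v h h∈H (h ⟨$⟩ˡ i))) (reflexive (≡.cong v (inverseʳ h {_})))

  -- The average is reindexed along h ↦ h g⁻¹, a bijection of H.
  θ-invariant : ∀ v → Invariant (θᴴ v)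
  θ-invariant v g g∈H i = *-congˡ
    (∑-reindex (permutationSetoid n) (permutationSetoid n) _≟ₚₑᵣₘ_ _≟ₚₑᵣₘ_ unique unique
      (_∘ₚ flipₚ g) (_∘ₚ g)
      (λ h≈k j → ≡.cong (g ⟨$⟩ˡ_) (h≈k j)) (λ h≈k j → ≡.cong (g ⟨$⟩ʳ_) (h≈k j))
      (λ {h} h∈ → ∘-closed {h} {flipₚ g} h∈ (⁻¹-closed {g} g∈H))
      (λ {h} h∈ → ∘-closed {h} {g} h∈ g∈H)
      (λ _ _ → inverseʳ g) (λ _ _ → inverseˡ g)
      (λ h → (v · h) i) (λ {h} {k} h≈k → reflexive (≡.cong v (⟨$⟩ˡ-cong {g = h} {k} h≈k i))))

  θ-fixes : ∀ {v} → Invariant v → θᴴ v ≋ v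
  θ-fixes {v} inv-v i = begin
    ν * ∑ (λ h → v (h ⟨$⟩ˡ i)) perms
      ≈⟨ *-congˡ (∑-cong-∈ perms λ {h} h∈ → invariant-⟨$⟩ˡ inv-v h (∈ᴸ⇒∈ᴳ H h∈) i) ⟩
    ν * ∑ (λ _ → v i) perms
      ≈⟨ *-congˡ (∑-const (v i) perms) ⟩
    ν * (order ×ᴺ v i)
      ≈⟨ ν*order× (v i) ⟩
    v i ∎

  -- Permuting the entries keeps their total, so the average of the permuted copies has that total
  -- too.
  sum-θ : ∀ f → sum (θᴴ f) ≈ sum f
  sum-θ f = begin
    sum (θᴴ f)
      ≈⟨ ∑-allFin n _ ⟨
    ∑ (λ i → ν * ∑ (λ h → f (h ⟨$⟩ˡ i)) perms) (allFin n)
      ≈⟨ *-distribˡ-∑ ν _ (allFin n) ⟨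
    ν * ∑ (λ i → ∑ (λ h → f (h ⟨$⟩ˡ i)) perms) (allFin n)
      ≈⟨ *-congˡ (∑-comm _ (allFin n) perms) ⟩
    ν * ∑ (λ h → ∑ (λ i → f (h ⟨$⟩ˡ i)) (allFin n)) perms
      ≈⟨ *-congˡ (∑-cong perms λ h → trans (∑-allFin n _) (sym (sum-permute f (flipₚ h)))) ⟩
    ν * ∑ (λ _ → sum f) perms
      ≈⟨ *-congˡ (∑-const (sum f) perms) ⟩
    ν * (order ×ᴺ sum f)
      ≈⟨ ν*order× (sum f) ⟩
    sum f ∎

  -- An invariant u can be moved inside the average, so the entrywise product of θ v and u is θ of
  -- the entrywise product of v and u; `sum-θ` then removes θ.
  ⟨θ,⟩ : ∀ v {u} → Invariant u → ⟨ θᴴ v , u ⟩ ≈ ⟨ v , u ⟩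
  ⟨θ,⟩ v {u} inv-u = trans (sum-cong-≋ {n} λ i → begin
    ν * ∑ (λ h → v (h ⟨$⟩ˡ i)) perms * u i
      ≈⟨ *-assoc ν _ (u i) ⟩
    ν * (∑ (λ h → v (h ⟨$⟩ˡ i)) perms * u i)
      ≈⟨ *-congˡ (*-distribʳ-∑ (u i) _ perms) ⟩
    ν * ∑ (λ h → v (h ⟨$⟩ˡ i) * u i) perms
      ≈⟨ *-congˡ (∑-cong-∈ perms λ {h} h∈ → *-congˡ (invariant-⟨$⟩ˡ inv-u h (∈ᴸ⇒∈ᴳ H h∈) i)) ⟨
    θᴴ (λ j → v j * u j) i ∎) (sum-θ (λ j → v j * u j))

  ⟨,θ⟩ : ∀ {u} v → Invariant u → ⟨ u , θᴴ v ⟩ ≈ ⟨ u , v ⟩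
  ⟨,θ⟩ {u} v inv-u = trans (sum-cong-≋ {n} λ i → begin
    u i * (ν * ∑ (λ h → v (h ⟨$⟩ˡ i)) perms)
      ≈⟨ trans (sym (*-assoc (u i) ν _)) (trans (*-congʳ (ν-central (u i))) (*-assoc ν (u i) _)) ⟩
    ν * (u i * ∑ (λ h → v (h ⟨$⟩ˡ i)) perms)
      ≈⟨ *-congˡ (*-distribˡ-∑ (u i) _ perms) ⟩
    ν * ∑ (λ h → u i * v (h ⟨$⟩ˡ i)) perms
      ≈⟨ *-congˡ (∑-cong-∈ perms λ {h} h∈ → *-congʳ (invariant-⟨$⟩ˡ inv-u h (∈ᴸ⇒∈ᴳ H h∈) i)) ⟨
    θᴴ (λ j → u j * v j) i ∎) (sum-θ (λ j → u j * v j))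

  module OrbitSums (O : Orbits H) where
    open Orbits O
    open OrbitMap H O

    -- The sum of w_i times the indicator vector of the i-th orbit. On invariant vectors `_∘ α` is
    -- its inverse.
    spread : (Fin t → Carrier) → V
    spread w j = w (orbit j)

    spread-invariant : ∀ w → Invariant (spread w)
    spread-invariant w h h∈H j = reflexive (≡.cong w (orbit-⟨$⟩ʳ {h} h∈H j))

    spread-α : ∀ w i → spread w (α i) ≈ w i
    spread-α w i = reflexive (≡.cong w (orbit-α i))

    invariant⇒spread : ∀ {v} → Invariant v → spread (v ∘ α) ≋ v
    invariant⇒spread {v} inv-v j with find (proj₂ (cover j))
    ... | h , h∈H , hα≡j =
      trans (sym (inv-v h (∈ᴸ⇒∈ᴳ H h∈H) (α (orbit j)))) (reflexive (≡.cong v hα≡j))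

    sum-spread : ∀ w → sum (spread w) ≈ sum (λ i → m i ×ᴺ w i)
    sum-spread w = begin
      sum (spread w)               ≈⟨ ∑-allFin n (spread w) ⟨
      ∑ (w ∘ orbit) (allFin n)
        ≈⟨ sum-fibres orbit (λ i j → _∈Orbit?_ H j (α i))
             (λ i j j∈ → disjoint (proj₂ (cover j)) j∈)
             (λ i j orbit≡i → ≡.subst (λ i → _∈Orbit_ H j (α i)) orbit≡i (proj₂ (cover j)))
             w (allFin n) ⟨
      sum (λ i → m i ×ᴺ w i)       ∎

    sum-invariant : ∀ {v} → Invariant v → sum v ≈ sum (λ i → m i ×ᴺ v (α i))
    sum-invariant {v} inv-v =
      trans (sum-cong-≋ {n} λ j → sym (invariant⇒spread inv-v j)) (sum-spread (v ∘ α))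

    pointMass : Fin t → V
    pointMass i j = [ α i ≟ᶠ j ] 1#

    -- θ preserves the sum of the entries, and the average of a point mass is constant
    -- on its orbit and 0 elsewhere, so m i times this value is 1.
    m⁻¹ : Fin t → Carrier
    m⁻¹ i = θᴴ (pointMass i) (α i)

    m*m⁻¹ : ∀ i → m i ×ᴺ m⁻¹ i ≈ 1#
    m*m⁻¹ i = sym (begin
      1#                                              ≈⟨ sum-delta (α i) (λ _ → 1#) ⟨
      sum (pointMass i)                               ≈⟨ sum-θ (pointMass i) ⟨
      sum (θᴴ (pointMass i))                          ≈⟨ sum-invariant (θ-invariant (pointMass i)) ⟩
      sum (λ k → m k ×ᴺ θᴴ (pointMass i) (α k))       ≈⟨ sum-cong-≋ {t} vanish ⟩
      sum (λ k → [ i ≟ᶠ k ] (m k ×ᴺ θᴴ (pointMass i) (α k)))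
        ≈⟨ sum-delta i (λ k → m k ×ᴺ θᴴ (pointMass i) (α k)) ⟩
      m i ×ᴺ m⁻¹ i                                    ∎)
      where
      ×-0 : ∀ k {x} → x ≈ 0# → k ×ᴺ x ≈ 0#
      ×-0 zero    x≈0 = refl
      ×-0 (suc k) x≈0 = trans (+-cong x≈0 (×-0 k x≈0)) (+-identityˡ 0#)

      vanish : ∀ k → m k ×ᴺ θᴴ (pointMass i) (α k) ≈ [ i ≟ᶠ k ] (m k ×ᴺ θᴴ (pointMass i) (α k))
      vanish k with i ≟ᶠ k
      ... | yes _   = refl
      ... | no  i≢k = ×-0 (m k) (trans (*-congˡ (trans
        (∑-cong-∈ perms λ {h} h∈ → []-no (α i ≟ᶠ (h ⟨$⟩ˡ α k)) (λ eq → i≢k (disjoint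
          (≡.subst (λ j → _∈Orbit_ H j (α i)) (≡.trans (≡.cong (h ⟨$⟩ʳ_) eq) (inverseʳ h {_}))
            (∈ᴳ⇒∈Orbit H {h} (∈ᴸ⇒∈ᴳ H h∈) (α i)))
          (∈ᴳ⇒∈Orbit H {idₚ} id-mem (α k)))) 1#)
        (∑-ε perms))) (zeroʳ ν))

    ·ᴹ-orbitLength : ∀ v k → (v ·ᴹ orbitLengthMatrix O) k ≈ v k * (m (orbit k) ×ᴺ 1#)
    ·ᴹ-orbitLength v k = begin
      sum (λ j → v j * ([ j ≟ᶠ k ] (orbitLength j ×ᴺ 1#)))
        ≈⟨ sum-cong-≋ {n} (λ j → entry j (j ≟ᶠ k) (k ≟ᶠ j)) ⟩
      sum (λ j → [ k ≟ᶠ j ] (v j * (orbitLength j ×ᴺ 1#)))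
        ≈⟨ sum-delta k (λ j → v j * (orbitLength j ×ᴺ 1#)) ⟩
      v k * (orbitLength k ×ᴺ 1#) ∎
      where
      entry : ∀ j (j≟k : Dec (j ≡ k)) (k≟j : Dec (k ≡ j)) →
        v j * ([ j≟k ] (orbitLength j ×ᴺ 1#)) ≈ [ k≟j ] (v j * (orbitLength j ×ᴺ 1#))
      entry j (yes _)   (yes _)   = refl
      entry j (no _)    (no _)    = zeroʳ (v j)
      entry j (yes j≡k) (no k≢j)  = contradiction (≡.sym j≡k) k≢j
      entry j (no j≢k)  (yes k≡j) = contradiction (≡.sym k≡j) j≢k

-- The dual of the averaged code in orbit coordinates.

module Duality (R : Ring c ℓ) (finite : Finite (Ring.setoid R)) (n : ℕ)
  (G H : PermGroup n) (H⊆G : ∀ h → h ∈ᴳ H → h ∈ᴳ G) (inv : Code.OrderInvertible R finite n H)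
  (O : Orbits H) (C : Code.LeftGCode R finite n G p) where
  open Ring R hiding (zero)
  open Code R finite n
  open PermGroup H using (perms)
  open RawMonoidDefs +-rawMonoid using (sum) renaming (_×_ to _×ᴺ_)
  open SumProps +-commutativeMonoid using (sum-cong-≋)
  open SemiringMult semiring using (×-comm-*; ×-congʳ)
  open SetoidReasoning setoid
  open Orbits O
  open OrbitMap H O
  open Averaging R finite n H inv
  open OrbitSums O
  open LeftGCode C

  Cθ : Subset V-setoid (c ⊔ ℓ ⊔ p)
  Cθ = imageθ H inv code

  C⊥θ : Subset V-setoid (c ⊔ ℓ ⊔ p)
  C⊥θ = imageθ H inv (code ^⊥)

  C⊥θM : Subset V-setoid (c ⊔ ℓ ⊔ p)
  C⊥θM = imageM O C⊥θ

  -- θ v is a left multiple of a sum of H-translates of v, and C is a left submodule stable under G,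
  -- which contains H.
  θ-closed : ∀ {v} → v ∈ code → θᴴ v ∈ code
  θ-closed {v} v∈C = *ₗ-closed ν (sums perms λ {h} h∈ → H⊆G h (∈ᴸ⇒∈ᴳ H {h} h∈))
    where
    sums : ∀ hs → (∀ {h} → h ∈ᴸ hs → h ∈ᴳ G) →
      (λ i → foldr _+_ 0# (map (λ h → (v · h) i) hs)) ∈ code
    sums []       hs∈G = 0-mem
    sums (h ∷ hs) hs∈G = +-closed (G-closed {h} (hs∈G {h} (here ≡.refl)) v∈C)
      (sums hs λ {k} k∈ → hs∈G {k} (there k∈))

  -- Together with `⇒∈Cθ` this identifies `Cθ` with the invariant words of C, for which the closure
  -- properties are immediate.
  ∈Cθ⇒ : ∀ {u} → u ∈ Cθ → u ∈ code × Invariant u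
  ∈Cθ⇒ (v , v∈C , θv≋u) =
    Subset.mem-resp code θv≋u (θ-closed v∈C) , invariant-resp θv≋u (θ-invariant v)

  ⇒∈Cθ : ∀ {u} → u ∈ code → Invariant u → u ∈ Cθ
  ⇒∈Cθ {u} u∈C inv-u = u , u∈C , θ-fixes inv-u

  Cθ-+-closed : ∀ {u v} → u ∈ Cθ → v ∈ Cθ → (λ i → u i + v i) ∈ Cθ
  Cθ-+-closed u∈ v∈ with ∈Cθ⇒ u∈ | ∈Cθ⇒ v∈
  ... | u∈C , inv-u | v∈C , inv-v =
    ⇒∈Cθ (+-closed u∈C v∈C) λ h h∈H i → +-cong (inv-u h h∈H i) (inv-v h h∈H i)

  Cθ-*ₗ-closed : ∀ r {u} → u ∈ Cθ → (λ i → r * u i) ∈ Cθ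
  Cθ-*ₗ-closed r u∈ with ∈Cθ⇒ u∈
  ... | u∈C , inv-u = ⇒∈Cθ (*ₗ-closed r u∈C) λ h h∈H i → *-congˡ (inv-u h h∈H i)

  Cθ-neg-closed : ∀ {u} → u ∈ Cθ → (λ i → - u i) ∈ Cθ
  Cθ-neg-closed {u} u∈ = Subset.mem-resp Cθ (λ i → -1*x≈-x (u i)) (Cθ-*ₗ-closed (- 1#) u∈)
    where open RingProps R using (-1*x≈-x)

  -- Unweighted, whereas `⟨_,_⟩` of two invariant vectors carries the weight m_i at orbit i. The
  -- factor M_H absorbs these weights.
  ⟪_,_⟫ : V → (Fin t → Carrier) → Carrier
  ⟪ u , w ⟫ = sum λ i → u (α i) * w i

  IsDual : (Fin t → Carrier) → Set _
  IsDual w = ∀ u → u ∈ Cθ → ⟪ u , w ⟫ ≈ 0#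

  C⊥θM-invariant : ∀ {v} → v ∈ C⊥θM → Invariant v
  C⊥θM-invariant {v} (y , (x , _ , θx≋y) , yM≋v) = invariant-resp yM≋v λ h h∈H i → begin
    (y ·ᴹ orbitLengthMatrix O) (h ⟨$⟩ʳ i)               ≈⟨ ·ᴹ-orbitLength y (h ⟨$⟩ʳ i) ⟩
    y (h ⟨$⟩ʳ i) * (m (orbit (h ⟨$⟩ʳ i)) ×ᴺ 1#)
      ≈⟨ *-cong (invariant-resp θx≋y (θ-invariant x) h h∈H i)
           (reflexive (≡.cong (λ k → m k ×ᴺ 1#) (orbit-⟨$⟩ʳ {h} h∈H i))) ⟩
    y i * (m (orbit i) ×ᴺ 1#)                           ≈⟨ ·ᴹ-orbitLength y i ⟨
    (y ·ᴹ orbitLengthMatrix O) i                        ∎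

  ⟨⟩≈sum-orbits : ∀ {u v} → Invariant u → Invariant v →
    ⟨ u , v ⟩ ≈ sum (λ i → m i ×ᴺ (u (α i) * v (α i)))
  ⟨⟩≈sum-orbits inv-u inv-v = sum-invariant λ h h∈H i → *-cong (inv-u h h∈H i) (inv-v h h∈H i)

  ∈C⊥θM⇒dual : ∀ {w} → spread w ∈ C⊥θM → IsDual w
  ∈C⊥θM⇒dual {w} (y , (x , x∈C⊥ , θx≋y) , yM≋w) u u∈ = begin
    sum (λ i → u (α i) * w i)                      ≈⟨ sum-cong-≋ {t} (λ i → *-congˡ (w≈ i)) ⟩
    sum (λ i → u (α i) * (y (α i) * (m i ×ᴺ 1#)))  ≈⟨ sum-cong-≋ {t} pull-m ⟩
    sum (λ i → m i ×ᴺ (u (α i) * y (α i)))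
      ≈⟨ ⟨⟩≈sum-orbits inv-u (invariant-resp θx≋y (θ-invariant x)) ⟨
    ⟨ u , y ⟩                                      ≈⟨ sum-cong-≋ {n} (λ i → *-congˡ (θx≋y i)) ⟨
    ⟨ u , θᴴ x ⟩                                   ≈⟨ ⟨,θ⟩ x inv-u ⟩
    ⟨ u , x ⟩                                      ≈⟨ x∈C⊥ u u∈C ⟩
    0#                                             ∎
    where
    u∈C : u ∈ code
    u∈C = proj₁ (∈Cθ⇒ u∈)
    inv-u : Invariant u
    inv-u = proj₂ (∈Cθ⇒ u∈)

    w≈ : ∀ i → w i ≈ y (α i) * (m i ×ᴺ 1#)
    w≈ i = begin
      w i                                 ≈⟨ spread-α w i ⟨
      spread w (α i)                      ≈⟨ yM≋w (α i) ⟨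
      (y ·ᴹ orbitLengthMatrix O) (α i)    ≈⟨ ·ᴹ-orbitLength y (α i) ⟩
      y (α i) * (m (orbit (α i)) ×ᴺ 1#)   ≡⟨ ≡.cong (λ k → y (α i) * (m k ×ᴺ 1#)) (orbit-α i) ⟩
      y (α i) * (m i ×ᴺ 1#)               ∎

    pull-m : ∀ i → u (α i) * (y (α i) * (m i ×ᴺ 1#)) ≈ m i ×ᴺ (u (α i) * y (α i))
    pull-m i = begin
      u (α i) * (y (α i) * (m i ×ᴺ 1#))   ≈⟨ *-assoc _ _ _ ⟨
      u (α i) * y (α i) * (m i ×ᴺ 1#)     ≈⟨ ×-comm-* (m i) _ 1# ⟩
      m i ×ᴺ (u (α i) * y (α i) * 1#)     ≈⟨ ×-congʳ (m i) (*-identityʳ _) ⟩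
      m i ×ᴺ (u (α i) * y (α i))          ∎

  -- The vector y of quotients is invariant, hence its own preimage under θ. Invariance also lets an
  -- arbitrary v in C be replaced by θ v in `Cθ`, the only words on which the hypothesis speaks.
  dual⇒∈C⊥θM : ∀ {w} → IsDual w → spread w ∈ C⊥θM
  dual⇒∈C⊥θM {w} dual = y , (y , y∈C⊥ , θ-fixes inv-y) , yM≋w
    where
    y₀ : Fin t → Carrier
    y₀ i = w i * m⁻¹ i

    y : V
    y = spread y₀

    inv-y : Invariant y
    inv-y = spread-invariant y₀

    y∈C⊥ : ∀ v → v ∈ code → ⟨ v , y ⟩ ≈ 0#
    y∈C⊥ v v∈C = begin
      ⟨ v , y ⟩                                        ≈⟨ ⟨θ,⟩ v inv-y ⟨
      ⟨ θᴴ v , y ⟩                                     ≈⟨ ⟨⟩≈sum-orbits (θ-invariant v) inv-y ⟩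
      sum (λ i → m i ×ᴺ (θᴴ v (α i) * y (α i)))        ≈⟨ sum-cong-≋ {t} cancel-m ⟩
      ⟪ θᴴ v , w ⟫                                     ≈⟨ dual (θᴴ v) (v , v∈C , λ _ → refl) ⟩
      0#                                               ∎
      where
      cancel-m : ∀ i → m i ×ᴺ (θᴴ v (α i) * y (α i)) ≈ θᴴ v (α i) * w i
      cancel-m i = begin
        m i ×ᴺ (θᴴ v (α i) * y (α i))          ≈⟨ ×-comm-* (m i) _ _ ⟨
        θᴴ v (α i) * (m i ×ᴺ y (α i))          ≈⟨ *-congˡ (×-congʳ (m i) (spread-α y₀ i)) ⟩
        θᴴ v (α i) * (m i ×ᴺ (w i * m⁻¹ i))    ≈⟨ *-congˡ (×-comm-* (m i) (w i) (m⁻¹ i)) ⟨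
        θᴴ v (α i) * (w i * (m i ×ᴺ m⁻¹ i))
          ≈⟨ *-congˡ (trans (*-congˡ (m*m⁻¹ i)) (*-identityʳ (w i))) ⟩
        θᴴ v (α i) * w i                       ∎

    yM≋w : (y ·ᴹ orbitLengthMatrix O) ≋ spread w
    yM≋w k = begin
      (y ·ᴹ orbitLengthMatrix O) k          ≈⟨ ·ᴹ-orbitLength y k ⟩
      y k * (m i ×ᴺ 1#)                     ≈⟨ ×-comm-* (m i) (y k) 1# ⟩
      m i ×ᴺ (y k * 1#)                     ≈⟨ ×-congʳ (m i) (*-identityʳ (y k)) ⟩
      m i ×ᴺ (w i * m⁻¹ i)                  ≈⟨ ×-comm-* (m i) (w i) (m⁻¹ i) ⟨
      w i * (m i ×ᴺ m⁻¹ i)                  ≈⟨ trans (*-congˡ (m*m⁻¹ i)) (*-identityʳ (w i)) ⟩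
      w i                                   ∎
      where i = orbit k

-- The MacWilliams transform of the weight enumerator.

module MacWilliams (R : Ring c ℓ) (finite : Finite (Ring.setoid R))
  (χ : Character R) (nondegenerate : CharacterValues.LeftNondegenerate R χ) (n : ℕ)
  (G H : PermGroup n) (H⊆G : ∀ h → h ∈ᴳ H → h ∈ᴳ G) (inv : Code.OrderInvertible R finite n H)
  (O : Orbits H) (C : Code.LeftGCode R finite n G p) where
  open Ring R hiding (zero)
  open Finite finite using (size; to; from; to-cong; to-from; from-to) renaming (_≟_ to _≟ᴿ_)
  open Character χ using (⟦_⟧)
  open CharacterValues R χ using (φ; φ-cong; φ-+; φ-0)
  open Code R finite n
  open Orbits O
  open Averaging R finite n H inv
  open OrbitSums O
  open Duality R finite n G H H⊆G inv O C
  open Polynomial size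
  module PS = PolynomialSemiring size
  module P = CommutativeSemiring PS.commutativeSemiring
  open PS using (const-cong; const-0; const-+; const-*)
  module R∑ = SumProps +-commutativeMonoid
  module ℂ∑ = ListSum ℂᴿ.+-commutativeMonoid
  module P∑ = ListSum P.+-commutativeMonoid
  module P∏ = ListSum P.*-commutativeMonoid
  module P∏′ = SumProps P.*-commutativeMonoid
  module P⟨∑⟩ = SemiringListSum P.semiring
  open RawMonoidDefs +-rawMonoid using (sum)
  open RawMonoidDefs ℂᴿ.+-rawMonoid using () renaming (_×_ to _×ᶜ_)

  module W = Code R finite t
  module Wᶠ = Finite W.V-finite

  V-group : Group _ _
  V-group = record
    { Carrier = V
    ; _≈_ = _≋_
    ; _∙_ = λ u v i → u i + v i
    ; ε = λ _ → 0#
    ; _⁻¹ = λ u i → - u i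
    ; isGroup = record
      { isMonoid = record
        { isSemigroup = record
          { isMagma = record
            { isEquivalence = Setoid.isEquivalence V-setoid
            ; ∙-cong = λ u≋ v≋ i → +-cong (u≋ i) (v≋ i)
            }
          ; assoc = λ u v w i → +-assoc (u i) (v i) (w i)
          }
        ; identity = (λ u i → +-identityˡ (u i)) , (λ u i → +-identityʳ (u i))
        }
      ; inverse = (λ u i → -‿inverseˡ (u i)) , (λ u i → -‿inverseʳ (u i))
      ; ⁻¹-cong = λ u≋ i → -‿cong (u≋ i)
      }
    }

  ⟪,⟫-congˡ : ∀ w {u v} → u ≋ v → ⟪ u , w ⟫ ≈ ⟪ v , w ⟫
  ⟪,⟫-congˡ w u≋v = R∑.sum-cong-≋ {t} λ i → *-congʳ (u≋v (α i))

  ⟪,⟫-+ : ∀ w u v → ⟪ (λ i → u i + v i) , w ⟫ ≈ ⟪ u , w ⟫ + ⟪ v , w ⟫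
  ⟪,⟫-+ w u v = trans (R∑.sum-cong-≋ {t} λ i → distribʳ (w i) (u (α i)) (v (α i)))
    (R∑.∑-distrib-+ {t} _ _)

  ⟪,⟫-*ₗ : ∀ w r u → ⟪ (λ i → r * u i) , w ⟫ ≈ r * ⟪ u , w ⟫
  ⟪,⟫-*ₗ w r u = trans (R∑.sum-cong-≋ {t} λ i → *-assoc r (u (α i)) (w i))
    (sym (SemiringSum.*-distribˡ-sum semiring {t} r _))

  codewords : List V
  codewords = elements V-finite Cθ

  ∣Cθ∣ : ℕ
  ∣Cθ∣ = ∣_∣ V-finite Cθ

  dual-sum : ∀ w (w∈? : Dec (spread w ∈ C⊥θM)) →
    ℂ∑.∑ (λ u → φ ⟪ u , w ⟫) codewords ≈ᶜ ℂ∑.[ w∈? ] (∣Cθ∣ ×ᶜ 1ᶜ)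
  dual-sum w (yes w∈) = ℂᴿ.trans
    (ℂ∑.∑-cong-∈ codewords λ {u} u∈ → φ-0 (∈C⊥θM⇒dual w∈ u
      (∈-elements⁻ V-finite Cθ (Any.map (Setoid.reflexive V-setoid) u∈))))
    (ℂ∑.∑-const 1ᶜ codewords)
  -- With u the code `Cθ` contains all r u, so a sum apart from 0 would make χ trivial on the left
  -- ideal generated by ⟪u, w⟫. Nondegeneracy would then place w in the dual.
  dual-sum w (no w∉) = ¬apart⇒≈0 λ apart → w∉ (dual⇒∈C⊥θM λ u u∈ →
    nondegenerate ⟪ u , w ⟫ λ r → ℂᴿ.trans (φ-cong (sym (⟪,⟫-*ₗ w r u)))
      (apart-character-sum V-group V-finite Cθ
        (λ {u} {v} → Cθ-+-closed {u} {v}) (λ {u} → Cθ-neg-closed {u})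
        (λ u → φ ⟪ u , w ⟫) (λ u≋v → φ-cong (⟪,⟫-congˡ w u≋v))
        (λ u v → ℂᴿ.trans (φ-cong (⟪,⟫-+ w u v)) (φ-+ _ _))
        apart (Cθ-*ₗ-closed r {u} u∈)))

  x : Carrier → Poly
  x a = X (to a)

  y : Carrier → Poly
  y a = sumₚ λ b → const (value ⟦ a * from b ⟧) *ₚ x (from b)

  x-cong : ∀ {a b} → a ≈ b → x a ≈ₚ x b
  x-cong a≈b = P.reflexive (≡.cong X (to-cong a≈b))

  y-cong : ∀ {a b} → a ≈ b → y a ≈ₚ y b
  y-cong a≈b = SumProps.sum-cong-≋ P.+-commutativeMonoid {size} λ k →
    P.*-congʳ (const-cong (φ-cong (*-congʳ a≈b)))

  monomial : (Fin t → Carrier) → Poly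
  monomial w = productₚ λ i → x (w i)

  monomial-cong : ∀ {v w} → (∀ i → v i ≈ w i) → monomial v ≈ₚ monomial w
  monomial-cong v≈w = P∏′.sum-cong-≋ {t} λ i → x-cong (v≈w i)

  -- Regroups factors: the exponent of z at a counts the orbits on which u has the entry a.
  product-count : ∀ (z : Carrier → Poly) → (∀ {a b} → a ≈ b → z a ≈ₚ z b) → ∀ u →
    productₚ (λ a → z (from a) ^ₚ count O (from a) u) ≈ₚ productₚ (λ i → z (u (α i)))
  product-count z z-cong u = P.trans
    (P∏.sum-fibres (λ i → to (u (α i))) (λ a i → u (α i) ≟ᴿ from a)
      (λ a i eq → ≡.trans (to-cong eq) (to-from a))
      (λ { a i ≡.refl → sym (from-to (u (α i))) }) (z ∘ from) (allFin t))
    (P.trans (P∏.∑-allFin t _) (P∏′.sum-cong-≋ {t} λ i → z-cong (from-to (u (α i)))))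

  product-const : ∀ k (a : Fin k → Carrier) →
    productₚ (λ i → const (φ (a i))) ≈ₚ const (φ (sum a))
  product-const zero    a = const-cong (ℂᴿ.sym (φ-0 refl))
  product-const (suc k) a = P.trans
    (P.*-congˡ {const (φ (a zero))} (product-const k (λ i → a (suc i))))
    (P.trans (P.sym (const-* _ _)) (const-cong (ℂᴿ.sym (φ-+ _ _))))

  const-∑ : ∀ {a} {A : Set a} (f : A → ℂ) us → P∑.∑ (const ∘ f) us ≈ₚ const (ℂ∑.∑ f us)
  const-∑ f []       = P.sym const-0
  const-∑ f (u ∷ us) = P.trans (P.+-congˡ (const-∑ f us)) (P.sym (const-+ _ _))

  indices : List (Fin Wᶠ.size)
  indices = allFin Wᶠ.size

  -- Choosing one summand b in each factor amounts to choosing a vector w of R^t, and the constants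
  -- χ(u_i w_i) multiply to χ of the pairing.
  product-y : ∀ u → productₚ (λ i → y (u (α i))) ≈ₚ
    P∑.∑ (λ k → const (φ ⟪ u , Wᶠ.from k ⟫) *ₚ monomial (Wᶠ.from k)) indices
  product-y u = begin
    productₚ (λ i → y (u (α i)))
      ≈⟨ Distribute.product-sum PS.commutativeSemiring t
           (λ i b → const (φ (u (α i) * from b)) *ₚ x (from b)) ⟩
    sumₚ {Wᶠ.size} (λ k → productₚ λ i → const (φ (u (α i) * Wᶠ.from k i)) *ₚ x (Wᶠ.from k i))
      ≈⟨ P∑.∑-allFin Wᶠ.size _ ⟨
    P∑.∑ (λ k → productₚ λ i → const (φ (u (α i) * Wᶠ.from k i)) *ₚ x (Wᶠ.from k i)) indices
      ≈⟨ P∑.∑-cong indices (λ k → P.trans (P∏′.∑-distrib-+ {t} _ _)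
           (P.*-congʳ (product-const t (λ i → u (α i) * Wᶠ.from k i)))) ⟩
    P∑.∑ (λ k → const (φ ⟪ u , Wᶠ.from k ⟫) *ₚ monomial (Wᶠ.from k)) indices ∎
    where open SetoidReasoning P.setoid

  -- Taken as the preimage of `C⊥θM` rather than from `IsDual`: decidability is then inherited, and
  -- the enumerator of `C⊥θM` can be reindexed along `spread`.
  dual : Subset W.V-setoid _
  dual = record
    { mem      = λ w → spread w ∈ C⊥θM
    ; mem?     = λ w → Subset.mem? C⊥θM (spread w)
    ; mem-resp = λ v≋w → Subset.mem-resp C⊥θM (λ j → v≋w _)
    }

  dual? : ∀ k → Dec (Wᶠ.from k ∈ dual)
  dual? k = Subset.mem? dual (Wᶠ.from k)

  -- All elements of `C⊥θM` are invariant, so `spread` and `_∘ α` are inverse bijections between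
  -- `dual` and `C⊥θM`.
  cwe-dual : cwe O C⊥θM x ≈ₚ P∑.∑ (λ k → P∑.[ dual? k ] monomial (Wᶠ.from k)) indices
  cwe-dual = begin
    cwe O C⊥θM x
      ≈⟨ P∑.∑-cong (elements V-finite C⊥θM) (product-count x x-cong) ⟩
    P∑.∑ (λ v → monomial (v ∘ α)) (elements V-finite C⊥θM)
      ≈⟨ P∑.∑-reindex W.V-setoid V-setoid Wᶠ._≟_ (Finite._≟_ V-finite)
           (elements-unique W.V-finite dual) (elements-unique V-finite C⊥θM) spread (_∘ α)
           (λ v≋w j → v≋w _) (λ u≋v i → u≋v (α i))
           (λ w∈ → ∈-elements⁺ V-finite C⊥θM (∈-elements⁻ W.V-finite dual w∈))
           (λ {v} v∈ → ∈-elements⁺ W.V-finite dual {v ∘ α} (Subset.mem-resp C⊥θM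
             (λ j → sym (invariant⇒spread (C⊥θM-invariant (∈-elements⁻ V-finite C⊥θM v∈)) j))
             (∈-elements⁻ V-finite C⊥θM v∈)))
           (λ {w} _ → spread-α w)
           (λ v∈ → invariant⇒spread (C⊥θM-invariant (∈-elements⁻ V-finite C⊥θM v∈)))
           (λ v → monomial (v ∘ α)) (λ u≋v → monomial-cong λ i → u≋v (α i)) ⟨
    P∑.∑ (λ w → monomial (spread w ∘ α)) (elements W.V-finite dual)
      ≈⟨ P∑.∑-cong (elements W.V-finite dual) (λ w → monomial-cong (spread-α w)) ⟩
    P∑.∑ monomial (elements W.V-finite dual)
      -- The filter becomes a bracket, so that the sum runs over all of R^t, as in `cwe-code`.
      ≈⟨ P∑.∑-filter (Subset.mem? dual) monomial (map Wᶠ.from indices) ⟩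
    P∑.∑ (λ w → P∑.[ Subset.mem? dual w ] monomial w) (map Wᶠ.from indices)
      ≡⟨ P∑.∑-map _ Wᶠ.from indices ⟩
    P∑.∑ (λ k → P∑.[ dual? k ] monomial (Wᶠ.from k)) indices ∎
    where open SetoidReasoning P.setoid

  cwe-code : cwe O Cθ y ≈ₚ
    P∑.∑ (λ k → const (ℂ∑.[ dual? k ] (∣Cθ∣ ×ᶜ 1ᶜ)) *ₚ monomial (Wᶠ.from k)) indices
  cwe-code = begin
    cwe O Cθ y
      ≈⟨ P∑.∑-cong codewords (λ u → P.trans (product-count y y-cong u) (product-y u)) ⟩
    P∑.∑ (λ u → P∑.∑ (λ k → const (φ ⟪ u , Wᶠ.from k ⟫) *ₚ monomial (Wᶠ.from k)) indices) codewords
      ≈⟨ P∑.∑-comm _ codewords indices ⟩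
    P∑.∑ (λ k → P∑.∑ (λ u → const (φ ⟪ u , Wᶠ.from k ⟫) *ₚ monomial (Wᶠ.from k)) codewords) indices
      ≈⟨ P∑.∑-cong indices (λ k → P.trans
           (P.sym (P⟨∑⟩.*-distribʳ-∑ (monomial (Wᶠ.from k)) _ codewords))
           (P.*-congʳ (P.trans (const-∑ _ codewords)
             (const-cong (dual-sum (Wᶠ.from k) (dual? k)))))) ⟩
    P∑.∑ (λ k → const (ℂ∑.[ dual? k ] (∣Cθ∣ ×ᶜ 1ᶜ)) *ₚ monomial (Wᶠ.from k)) indices ∎
    where open SetoidReasoning P.setoid

  macWilliams : .{{_ : ℕ.NonZero ∣Cθ∣}} → cwe O C⊥θM x ≈ₚ const (1/ᶜ ∣Cθ∣) *ₚ cwe O Cθ y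
  macWilliams = begin
    cwe O C⊥θM x
      ≈⟨ cwe-dual ⟩
    P∑.∑ (λ k → P∑.[ dual? k ] monomial (Wᶠ.from k)) indices
      ≈⟨ P∑.∑-cong indices (λ k → scale (dual? k) (monomial (Wᶠ.from k))) ⟩
    P∑.∑ (λ k → const (1/ᶜ ∣Cθ∣) *ₚ
      (const (ℂ∑.[ dual? k ] (∣Cθ∣ ×ᶜ 1ᶜ)) *ₚ monomial (Wᶠ.from k))) indices
      ≈⟨ P⟨∑⟩.*-distribˡ-∑ (const (1/ᶜ ∣Cθ∣)) _ indices ⟨
    const (1/ᶜ ∣Cθ∣) *ₚ
      P∑.∑ (λ k → const (ℂ∑.[ dual? k ] (∣Cθ∣ ×ᶜ 1ᶜ)) *ₚ monomial (Wᶠ.from k)) indices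
      ≈⟨ P.*-congˡ {const (1/ᶜ ∣Cθ∣)} cwe-code ⟨
    const (1/ᶜ ∣Cθ∣) *ₚ cwe O Cθ y ∎
    where
    open SetoidReasoning P.setoid
    scale : ∀ {a} {A : Set a} (A? : Dec A) f →
      P∑.[ A? ] f ≈ₚ const (1/ᶜ ∣Cθ∣) *ₚ (const (ℂ∑.[ A? ] (∣Cθ∣ ×ᶜ 1ᶜ)) *ₚ f)
    scale (yes _) f = begin
      f                                                            ≈⟨ P.*-identityˡ f ⟨
      const 1ᶜ *ₚ f
        ≈⟨ P.*-congʳ (const-cong (1/ᶜ*× ∣Cθ∣)) ⟨
      const ((1/ᶜ ∣Cθ∣) *ᶜ ∣Cθ∣ ×ᶜ 1ᶜ) *ₚ f
        ≈⟨ P.*-congʳ {f} (const-* (1/ᶜ ∣Cθ∣) (∣Cθ∣ ×ᶜ 1ᶜ)) ⟩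
      const (1/ᶜ ∣Cθ∣) *ₚ const (∣Cθ∣ ×ᶜ 1ᶜ) *ₚ f
        ≈⟨ P.*-assoc (const (1/ᶜ ∣Cθ∣)) (const (∣Cθ∣ ×ᶜ 1ᶜ)) f ⟩
      const (1/ᶜ ∣Cθ∣) *ₚ (const (∣Cθ∣ ×ᶜ 1ᶜ) *ₚ f)                ∎
    scale (no _)  f = begin
      []                                          ≈⟨ P.zeroʳ (const (1/ᶜ ∣Cθ∣)) ⟨
      const (1/ᶜ ∣Cθ∣) *ₚ []
        ≈⟨ P.*-congˡ {const (1/ᶜ ∣Cθ∣)} (P.*-congʳ {f} const-0) ⟨
      const (1/ᶜ ∣Cθ∣) *ₚ (const 0ᶜ *ₚ f)         ∎

theorem3p4 :
  ∀ {c ℓ p} (R : Ring c ℓ) (finite : Finite (Ring.setoid R)) →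
  IsFrobenius R →
  (χ : Character R) → IsGenerating R χ →
  (n : ℕ) (G H : PermGroup n) → H ≤ᴳ G →
  let open Ring R using (_*_)
      open Finite finite
      open Polynomial size
      open Code R finite n
      open Character χ
  in
  (∣H∣⁻¹ : OrderInvertible H) (O : Orbits H) (C : LeftGCode G p) →
  let x = λ a → X (to a)
      C₀ = LeftGCode.code C
      Cθ = imageθ H ∣H∣⁻¹ C₀
      C⊥θM = imageM O (imageθ H ∣H∣⁻¹ (C₀ ^⊥))
      instance ∣Cθ∣≢0 = ∣imageθ∣-nonZero H ∣H∣⁻¹ C
  in
  cwe O C⊥θM x
    ≈ₚ
  const (1/ᶜ (∣_∣ V-finite Cθ)) *ₚ
    cwe O Cθ (λ a → sumₚ (λ b → const (value (⟦ a * from b ⟧)) *ₚ x (from b)))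
theorem3p4 R finite _ χ generating n G H H≤G ∣H∣⁻¹ O C =
  MacWilliams.macWilliams R finite χ nondegenerate n G H (λ h → H≤G {h}) ∣H∣⁻¹ O C
    {{∣imageθ∣-nonZero H ∣H∣⁻¹ C}}
  where
  open Code R finite n using (∣imageθ∣-nonZero)
  nondegenerate = CharacterValues.generating⇒leftNondegenerate R χ finite generating
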